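{- Let $(X,d)$ be a finite metric space with $n$ points, let $\epsilon>0$ be a real number, and let $k$ be an integer with $k\ge n^2/\epsilon$. For every $\alpha$, if there exists a (fully) randomized algorithm for metrical task systems on $(X,d)$ that is $\alpha$-competitive, then there exists a $k$-barely random algorithm for metrical task systems on $(X,d)$ that is $(1+\epsilon)\alpha$-competitive.
   Context: Metrical task systems (MTS) on a finite metric space $(X,d)$: the input is a sequence of cost vectors $c=(c(t))_{t\ge 1}$ with $c(t)\in\mathbb{R}_+^X$; the output is a sequence of states $\rho=(\rho(t))_{t\ge 0}$ in $X$. Its cost is $\mathrm{Cost}(\rho,c)=\sum_{t\ge 1}\big(d(\rho(t-1),\rho(t))+c_{\rho(t)}(t)\big)$, and $\mathrm{OPT}(c)=\inf_{\rho\in X^{\mathbb{N}}}\mathrm{Cost}(\rho,c)$. An online algorithm $\mathcal{A}$ with seed distribution $\mathcal{D}$ draws one seed $s\sim\mathcal{D}$ and outputs $\rho_{\mathcal A}(t)=\mathcal{A}(c(1),\dots,c(t),s)$ for all $t\ge 0$ (so the state at time $t$ depends only on the seed and on $c(1),\dots,c(t)$). It is $\alpha$-competitive if there is a constant $\beta\in\mathbb{R}$ such that $\mathbb{E}_{s\sim\mathcal{D}}[\mathrm{Cost}(\rho_{\mathcal A},c)]\le\alpha\,\mathrm{OPT}(c)+\beta$ for every cost sequence $c$. A (fully) randomized algorithm is one with $\mathcal{D}$ the uniform distribution on $\{0,1\}^{\mathbb{N}}$ (an infinite sequence of independent fair bits). A $k$-barely random algorithm is one with $\mathcal{D}$ the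 uniform distribution on $\{1,\dots,k\}$. -}

module Defs where

open import Level using (0ℓ)
open import Algebra.Bundles using (CommutativeRing)
import Algebra.Properties.Monoid.Mult as Mult
import Algebra.Properties.Monoid.Sum as Sum
open import Axiom.ExcludedMiddle using (ExcludedMiddle)
open import Data.Bool.Base using (Bool; if_then_else_)
open import Data.Fin.Base using (Fin; toℕ)
open import Data.List.Base using (List; length; lookup; applyUpTo)
open import Data.List.Relation.Binary.Pointwise.Base using (Pointwise)
open import Data.Nat.Base as ℕ using (ℕ; suc)
open import Data.Product.Base using (Σ; ∃; _×_; _,_; proj₁; proj₂)
open import Data.Sum.Base using (_⊎_; inj₁)
open import Data.Unit.Base using (⊤)
open import Function.Bundles using (_↔_)
open import Function.Metric.Structures using (IsGeneralMetric)
open import Relation.Binary.Core using (Rel)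
import Relation.Binary.Construct.Add.Supremum.Equality as AddSupEquality
import Relation.Binary.Construct.Add.Supremum.NonStrict as AddSupOrder
import Relation.Binary.Construct.NonStrictToStrict as ToStrict
open import Relation.Binary.PropositionalEquality.Core as ≡ using (_≡_; _≢_)
open import Relation.Binary.Structures using (IsTotalOrder)
open import Relation.Nullary.Construct.Add.Supremum using (_⁺; ⊤⁺; [_])
open import Relation.Nullary.Decidable.Core using (yes; no; does)
open import Relation.Nullary.Negation.Core using (¬_)
open import Relation.Unary using (Pred; _≐_; ∁; ⋃; _∩_; Empty)

module _ {A : Set} (_≤_ : Rel A 0ℓ) where

  UpperBound : Pred A 0ℓ → Pred A 0ℓ
  UpperBound S b = ∀ {x} → S x → x ≤ b

  IsSupremum : Pred A 0ℓ → Pred A 0ℓ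
  IsSupremum S u = UpperBound S u × (∀ {b} → UpperBound S b → u ≤ b)

-- The real numbers, specified as a Dedekind-complete totally ordered field
-- (unique up to isomorphism).  Equality is a setoid equality, so that the
-- specification can be met by setoids of Cauchy sequences of rationals.
-- The inverse is total, with 0# ⁻¹ unspecified.
record CompleteOrderedField : Set₁ where
  infix  4 _≤_
  infix 10 _⁻¹
  field
    commutativeRing : CommutativeRing 0ℓ 0ℓ
  open CommutativeRing commutativeRing public renaming (Carrier to ℝ)
  field
    _≤_          : Rel ℝ 0ℓ
    isTotalOrder : IsTotalOrder _≈_ _≤_
    +-monoˡ-≤    : ∀ {x y} z → x ≤ y → x + z ≤ y + z
    *-nonNeg     : ∀ {x y} → 0# ≤ x → 0# ≤ y → 0# ≤ x * y
    0≉1          : ¬ (0# ≈ 1#)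
    _⁻¹          : ℝ → ℝ
    ⁻¹-cong      : ∀ {x y} → x ≈ y → x ⁻¹ ≈ y ⁻¹
    *-inverseʳ   : ∀ {x} → ¬ (x ≈ 0#) → x * x ⁻¹ ≈ 1#
    complete     : (S : Pred ℝ 0ℓ) → ∃ S → ∃ (UpperBound _≤_ S) →
                   ∃ (IsSupremum _≤_ S)

  open ToStrict _≈_ _≤_ public using (_<_)
  open Sum +-monoid public using (sum)

  fromℕ : ℕ → ℝ
  fromℕ n = Mult._×_ +-monoid n 1#

Seed : Set
Seed = ℕ → Bool

Cylinder : List Bool → Pred Seed 0ℓ
Cylinder w s = ∀ (i : Fin (length w)) → s (toℕ i) ≡ lookup w i

-- Codes for the elements of the σ-algebra generated by the cylinders; coding
-- keeps measurability in the lowest universe.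
data BorelCode : Set where
  cylinder   : List Bool → BorelCode
  complement : BorelCode → BorelCode
  union      : (ℕ → BorelCode) → BorelCode

⟦_⟧ : BorelCode → Pred Seed 0ℓ
⟦ cylinder w ⟧   = Cylinder w
⟦ complement b ⟧ = ∁ ⟦ b ⟧
⟦ union b ⟧      = ⋃ ℕ (λ i → ⟦ b i ⟧)

Borel : Pred (Pred Seed 0ℓ) 0ℓ
Borel S = ∃ λ b → S ≐ ⟦ b ⟧

module MTS (em : ExcludedMiddle 0ℓ) (ℛ : CompleteOrderedField) where
  open CompleteOrderedField ℛ

  ℝ∞ : Set
  ℝ∞ = ℝ ⁺

  open AddSupEquality _≈_ public using () renaming (_≈⁺_ to _≈∞_)
  open AddSupOrder _≤_ public using () renaming (_≤⁺_ to _≤∞_)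

  -- Suprema and infima are taken in [0,∞]: 0# is always adjoined to the
  -- family, so ⨆ of the empty family is 0 and ⨅ of the empty family is ∞.
  ⨆ : {I : Set} → (I → ℝ) → ℝ∞
  ⨆ f with em {∃ (UpperBound _≤_ (λ x → x ≡ 0# ⊎ ∃ λ i → x ≡ f i))}
  ... | yes bounded = [ proj₁ (complete _ (0# , inj₁ ≡.refl) bounded) ]
  ... | no  _       = ⊤⁺

  ⨅ : {I : Set} → (I → ℝ∞) → ℝ∞
  ⨅ f = ⨆ {∃ λ r → ∀ i → [ r ] ≤∞ f i} proj₁

  -- The sum of a series of nonnegative terms.
  Σ∞ : (ℕ → ℝ) → ℝ∞
  Σ∞ f = ⨆ λ N → sum {N} (λ i → f (toℕ i))

  -- α v + β.  The value at ∞ is that of extended arithmetic for α > 0; a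
  -- competitive ratio is never below 1: charge 1 in every state for finitely many
  -- steps, then 0.
  affine : ℝ → ℝ → ℝ∞ → ℝ∞
  affine α β [ v ] = [ α * v + β ]
  affine α β ⊤⁺    = ⊤⁺

  record SeedDistribution : Set₁ where
    field
      Ω          : Set
      Measurable : Pred (Pred Ω 0ℓ) 0ℓ
      Pr         : Pred Ω 0ℓ → ℝ

  module _ (𝒟 : SeedDistribution) where
    open SeedDistribution 𝒟

    -- A nonnegative simple function s ↦ value (cell s) lying below F, given by
    -- a finite measurable partition of Ω and its value on each cell.
    record SimpleBelow (F : Ω → ℝ∞) : Set where
      field
        size       : ℕ
        cell       : Ω → Fin size
        measurable : ∀ j → Measurable (λ s → cell s ≡ j)
        value      : Fin size → ℝ
        nonneg     : ∀ j → 0# ≤ value j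
        below      : ∀ s → [ value (cell s) ] ≤∞ F s

    ∫simple : ∀ {F} → SimpleBelow F → ℝ
    ∫simple g = sum λ j → value j * Pr (λ s → cell s ≡ j)
      where open SimpleBelow g

    -- The Lebesgue integral of F : Ω → [0,∞].
    𝔼 : (Ω → ℝ∞) → ℝ∞
    𝔼 F = ⨆ (∫simple {F})

  -- The distribution of a sequence of independent fair bits: the (unique)
  -- Borel measure giving each cylinder on m bits mass 2^(-m).  Total mass 1 is
  -- the case of the empty cylinder.  Pr is unconstrained off the Borel sets.
  record FairCoinMeasure : Set₁ where
    field
      Pr          : Pred Seed 0ℓ → ℝ
      Pr-cong     : ∀ {S T} → Borel S → S ≐ T → Pr S ≈ Pr T
      Pr-nonneg   : ∀ {S} → Borel S → 0# ≤ Pr S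
      Pr-⋃        : ∀ (S : ℕ → Pred Seed 0ℓ) → (∀ i → Borel (S i)) →
                    (∀ i j → i ≢ j → Empty (S i ∩ S j)) →
                    Σ∞ (λ i → Pr (S i)) ≈∞ [ Pr (⋃ ℕ S) ]
      Pr-cylinder : ∀ w → Pr (Cylinder w) ≈ fromℕ (2 ℕ.^ length w) ⁻¹

  fairBits : FairCoinMeasure → SeedDistribution
  fairBits μ = record
    { Ω = Seed ; Measurable = Borel ; Pr = FairCoinMeasure.Pr μ }

  -- The uniform distribution on a k-element set; meaningful for k ≥ 1 only.
  uniform : ℕ → SeedDistribution
  uniform k = record
    { Ω          = Fin k
    ; Measurable = λ _ → ⊤
    ; Pr         = λ S → sum (λ i → if does (em {S i}) then 1# else 0#) * fromℕ k ⁻¹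
    }

  record FiniteMetricSpace (n : ℕ) : Set₁ where
    field
      Point    : Set
      enum     : Fin n ↔ Point
      d        : Point → Point → ℝ
      isMetric : IsGeneralMetric _≡_ _≈_ _≤_ 0# _+_ d

  module _ {n : ℕ} (X : FiniteMetricSpace n) where
    open FiniteMetricSpace X

    CostVector : Set
    CostVector = Point → ∃ λ r → 0# ≤ r

    _≋_ : Rel CostVector 0ℓ
    u ≋ v = ∀ x → proj₁ (u x) ≈ proj₁ (v x)

    -- c t is the cost vector at time t + 1; ρ t is the state at time t.
    Cost : (ℕ → Point) → (ℕ → CostVector) → ℝ∞
    Cost ρ c = Σ∞ λ t → d (ρ t) (ρ (suc t)) + proj₁ (c t (ρ (suc t)))

    OPT : (ℕ → CostVector) → ℝ∞
    OPT c = ⨅ λ ρ → Cost ρ c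

    -- The list argument of act holds the past cost vectors, oldest first.
    -- act-cong says that act is a function on real vectors rather than on
    -- their representatives.
    record OnlineAlgorithm (𝒟 : SeedDistribution) : Set where
      open SeedDistribution 𝒟
      field
        act            : List CostVector → Ω → Point
        act-cong       : ∀ {us vs} → Pointwise _≋_ us vs → ∀ s → act us s ≡ act vs s
        act-measurable : ∀ us x → Measurable (λ s → act us s ≡ x)

      run : (ℕ → CostVector) → Ω → ℕ → Point
      run c s t = act (applyUpTo c t) s

    Competitive : ∀ {𝒟} → OnlineAlgorithm 𝒟 → ℝ → Set
    Competitive {𝒟} 𝒜 α =
      ∃ λ β → ∀ c → 𝔼 𝒟 (λ s → Cost (run c s) c) ≤∞ affine α β (OPT c)
      where open OnlineAlgorithm 𝒜

    RandomizedCompetitive : ℝ → Set₁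
    RandomizedCompetitive α =
      Σ FairCoinMeasure λ μ → Σ (OnlineAlgorithm (fairBits μ)) λ 𝒜 → Competitive 𝒜 α

    BarelyRandomCompetitive : ℕ → ℝ → Set
    BarelyRandomCompetitive k α =
      Σ (OnlineAlgorithm (uniform k)) λ 𝒜 → Competitive 𝒜 α

{-# OPTIONS --safe #-}

-- Let p(t) be the law of the state of the randomized algorithm and π(t) the joint law of the states
-- at times t and t + 1, both computable online.  Put κ = k (1 + ε).  The cumulative flow
-- F(t) = F(0) + κ Σ_{s<t} π(s) moves mass out of x₀, where k agents start, so that the amount at x
-- is at most κ p_x(t) − n; this is possible since κ − n² ≥ k.  Along each of the n² edges, the
-- agents are offered ⌊F(t)⌋ moves in total, and an agent standing at the tail of an edge that has
-- an offer left takes it.  An occupied point has no offers left, so rounding down its n outgoing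
-- edges leaves at most κ p_x(t) agents there.  Hence the agents pay at most κ times the expected
-- service and movement cost of the randomized algorithm, plus the constant cost of F(0), and a
-- uniformly chosen agent pays 1/k of that.
module Submission where

open import Level using (0ℓ)
import Algebra.Properties.Ring as RingProperties
import Algebra.Properties.Semiring.Mult as SemiringMult
import Algebra.Properties.Semiring.Sum as SemiringSum
import Algebra.Solver.Ring.NaturalCoefficients.Default as SemiringSolver
open import Axiom.ExcludedMiddle using (ExcludedMiddle)
open import Data.Bool.Base using (false; if_then_else_)
open import Data.Fin.Base using (Fin; zero; suc; toℕ; fromℕ<; combine; quotient; remainder; _↑ˡ_; _↑ʳ_)
import Data.Fin.Properties as Fin
open import Data.List.Base using (List; []; _∷_; length; take; applyUpTo)
open import Data.List.Properties using (length-applyUpTo)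
open import Data.List.Relation.Binary.Pointwise as Pointwise using (Pointwise; []; _∷_)
open import Data.Nat.Base as ℕ using (ℕ; zero; suc)
import Data.Nat.Properties as ℕ
open import Algebra.Definitions.RawMonoid ℕ.+-0-rawMonoid using () renaming (sum to sumℕ)
open import Data.Product.Base using (∃; _×_; _,_; proj₁; proj₂)
open import Data.Sum.Base using (_⊎_; inj₁; inj₂)
open import Data.Unit.Base using (tt)
open import Data.Vec.Base using (Vec; tabulate; lookup)
open import Data.Vec.Properties using (lookup∘tabulate; tabulate-cong)
open import Function.Base using (_∘_; id)
open import Function.Bundles using (Inverse)
open import Function.Metric.Structures using (IsGeneralMetric)
import Relation.Binary.Construct.Add.Supremum.Equality as AddSupEquality
import Relation.Binary.Construct.Add.Supremum.NonStrict as AddSupOrder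
open import Relation.Binary.Bundles using (Poset)
open import Relation.Binary.PropositionalEquality as ≡ using (_≡_; _≢_)
import Relation.Binary.Reasoning.PartialOrder as PartialOrderReasoning
open import Relation.Binary.Structures using (IsTotalOrder)
open import Relation.Nullary.Construct.Add.Supremum using (⊤⁺; [_])
open import Relation.Nullary.Decidable using (Dec; yes; no; does; does-≡; _×-dec_)
open import Relation.Nullary.Negation using (¬_; contradiction)
open import Relation.Unary using (Pred; _≐_; ⋃; _∩_; Empty)
open import Defs

-- Ordered field arithmetic and finite sums

module OrderedField (ℛ : CompleteOrderedField) where
  open CompleteOrderedField ℛ hiding (zero)
  open IsTotalOrder isTotalOrder public using (total; antisym; isPartialOrder)
    renaming (refl to ≤-refl; reflexive to ≤-reflexive; trans to ≤-trans)
  open RingProperties ring public using (-‿involutive; -‿distribˡ-*)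
  open SemiringMult semiring public using (×1-homo-*)
  open SemiringSum semiring public
    using (sum-cong-≋; sum-replicate; sum-replicate-zero;
           ∑-distrib-+; ∑-comm; *-distribˡ-sum; *-distribʳ-sum)
  open SemiringSolver commutativeSemiring public using (solve; _:=_; _:+_; _:*_; con)

  poset : Poset 0ℓ 0ℓ 0ℓ
  poset = record { isPartialOrder = isPartialOrder }

  open PartialOrderReasoning poset public

  +-monoʳ-≤ : ∀ {x y} z → x ≤ y → z + x ≤ z + y
  +-monoʳ-≤ {x} {y} z x≤y = begin
    z + x ≈⟨ +-comm z x ⟩
    x + z ≤⟨ +-monoˡ-≤ z x≤y ⟩
    y + z ≈⟨ +-comm y z ⟩
    z + y ∎

  +-mono-≤ : ∀ {x y u v} → x ≤ y → u ≤ v → x + u ≤ y + v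
  +-mono-≤ x≤y u≤v = ≤-trans (+-monoˡ-≤ _ x≤y) (+-monoʳ-≤ _ u≤v)

  +-nonneg : ∀ {x y} → 0# ≤ x → 0# ≤ y → 0# ≤ x + y
  +-nonneg 0≤x 0≤y = ≤-trans (≤-reflexive (sym (+-identityˡ 0#))) (+-mono-≤ 0≤x 0≤y)

  +-cancelʳ-≤ : ∀ z {x y} → x + z ≤ y + z → x ≤ y
  +-cancelʳ-≤ z {x} {y} le = begin
    x             ≈⟨ cancel x ⟨
    x + z + - z   ≤⟨ +-monoˡ-≤ (- z) le ⟩
    y + z + - z   ≈⟨ cancel y ⟩
    y             ∎
    where
    cancel : ∀ w → w + z + - z ≈ w
    cancel w = trans (+-assoc w z (- z)) (trans (+-congˡ (-‿inverseʳ z)) (+-identityʳ w))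

  x+y≤z⇒x≤z-y : ∀ {x y z} → x + y ≤ z → x ≤ z + - y
  x+y≤z⇒x≤z-y {x} {y} {z} le = +-cancelʳ-≤ y (begin
    x + y          ≤⟨ le ⟩
    z              ≈⟨ +-identityʳ z ⟨
    z + 0#         ≈⟨ +-congˡ (-‿inverseˡ y) ⟨
    z + (- y + y)  ≈⟨ +-assoc z (- y) y ⟨
    z + - y + y    ∎)

  x≤z-y⇒x+y≤z : ∀ {x y z} → x ≤ z + - y → x + y ≤ z
  x≤z-y⇒x+y≤z {x} {y} {z} le = begin
    x + y          ≤⟨ +-monoˡ-≤ y le ⟩
    z + - y + y    ≈⟨ +-assoc z (- y) y ⟩
    z + (- y + y)  ≈⟨ +-congˡ (-‿inverseˡ y) ⟩
    z + 0#         ≈⟨ +-identityʳ z ⟩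
    z              ∎

  x≤x+y : ∀ x {y} → 0# ≤ y → x ≤ x + y
  x≤x+y x 0≤y = ≤-trans (≤-reflexive (sym (+-identityʳ x))) (+-monoʳ-≤ x 0≤y)

  x≤0⇒0≤-x : ∀ {x} → x ≤ 0# → 0# ≤ - x
  x≤0⇒0≤-x {x} x≤0 = +-cancelʳ-≤ x (begin
    0# + x   ≈⟨ +-identityˡ x ⟩
    x        ≤⟨ x≤0 ⟩
    0#       ≈⟨ -‿inverseˡ x ⟨
    - x + x  ∎)

  *-monoˡ-≤ : ∀ {z} → 0# ≤ z → ∀ {x y} → x ≤ y → z * x ≤ z * y
  *-monoˡ-≤ {z} 0≤z {x} {y} x≤y = begin
    z * x                  ≤⟨ x≤x+y _ (*-nonNeg 0≤z 0≤y-x) ⟩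
    z * x + z * (y + - x)  ≈⟨ distribˡ z x (y + - x) ⟨
    z * (x + (y + - x))    ≈⟨ *-congˡ (+-congˡ (+-comm y (- x))) ⟩
    z * (x + (- x + y))    ≈⟨ *-congˡ (+-assoc x (- x) y) ⟨
    z * (x + - x + y)      ≈⟨ *-congˡ (+-congʳ (-‿inverseʳ x)) ⟩
    z * (0# + y)           ≈⟨ *-congˡ (+-identityˡ y) ⟩
    z * y                  ∎
    where
    0≤y-x : 0# ≤ y + - x
    0≤y-x = ≤-trans (≤-reflexive (sym (-‿inverseʳ x))) (+-monoˡ-≤ (- x) x≤y)

  *-monoʳ-≤ : ∀ {z} → 0# ≤ z → ∀ {x y} → x ≤ y → x * z ≤ y * z
  *-monoʳ-≤ {z} 0≤z {x} {y} x≤y = begin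
    x * z ≈⟨ *-comm x z ⟩
    z * x ≤⟨ *-monoˡ-≤ 0≤z x≤y ⟩
    z * y ≈⟨ *-comm z y ⟩
    y * z ∎

  -- Totality leaves the case `1# ≤ 0#`, in which `- 1#` is nonnegative and `1#` is its square.
  0≤1 : 0# ≤ 1#
  0≤1 with total 0# 1#
  ... | inj₁ 0≤1 = 0≤1
  ... | inj₂ 1≤0 = begin
    0#             ≤⟨ *-nonNeg (x≤0⇒0≤-x 1≤0) (x≤0⇒0≤-x 1≤0) ⟩
    - 1# * - 1#    ≈⟨ -‿distribˡ-* 1# (- 1#) ⟨
    - (1# * - 1#)  ≈⟨ -‿cong (*-identityˡ (- 1#)) ⟩
    - (- 1#)       ≈⟨ -‿involutive 1# ⟩
    1#             ∎

  1≰0 : ¬ (1# ≤ 0#)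
  1≰0 1≤0 = 0≉1 (antisym 0≤1 1≤0)

  ⁻¹-nonneg : ∀ {x} → 0# ≤ x → ¬ (x ≈ 0#) → 0# ≤ x ⁻¹
  ⁻¹-nonneg {x} 0≤x x≉0 with total 0# (x ⁻¹)
  ... | inj₁ 0≤x⁻¹ = 0≤x⁻¹
  ... | inj₂ x⁻¹≤0 = contradiction (begin
    1#        ≈⟨ *-inverseʳ x≉0 ⟨
    x * x ⁻¹  ≤⟨ *-monoˡ-≤ 0≤x x⁻¹≤0 ⟩
    x * 0#    ≈⟨ zeroʳ x ⟩
    0#        ∎) 1≰0

  fromℕ-nonneg : ∀ m → 0# ≤ fromℕ m
  fromℕ-nonneg zero    = ≤-refl
  fromℕ-nonneg (suc m) = +-nonneg 0≤1 (fromℕ-nonneg m)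

  fromℕ-mono : ∀ {m n} → m ℕ.≤ n → fromℕ m ≤ fromℕ n
  fromℕ-mono {n = n} ℕ.z≤n = fromℕ-nonneg n
  fromℕ-mono (ℕ.s≤s m≤n)   = +-monoʳ-≤ 1# (fromℕ-mono m≤n)

  fromℕ-suc≰0 : ∀ m → ¬ (fromℕ (suc m) ≤ 0#)
  fromℕ-suc≰0 m le = 1≰0 (≤-trans (x≤x+y 1# (fromℕ-nonneg m)) le)

  sum-mono : ∀ {n} {f g : Fin n → ℝ} → (∀ i → f i ≤ g i) → sum f ≤ sum g
  sum-mono {zero}  f≤g = ≤-refl
  sum-mono {suc n} f≤g = +-mono-≤ (f≤g zero) (sum-mono (f≤g ∘ suc))

  sum-nonneg : ∀ {n} {f : Fin n → ℝ} → (∀ i → 0# ≤ f i) → 0# ≤ sum f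
  sum-nonneg {n} 0≤f = ≤-trans (≤-reflexive (sym (sum-replicate-zero n))) (sum-mono 0≤f)

  sum-zero : ∀ {n} {f : Fin n → ℝ} → (∀ i → f i ≈ 0#) → sum f ≈ 0#
  sum-zero {n} f≈0 = trans (sum-cong-≋ f≈0) (sum-replicate-zero n)

  sum-const : ∀ n x → sum {n} (λ _ → x) ≈ fromℕ n * x
  sum-const n x = begin-equality
    sum {n} (λ _ → x)       ≈⟨ sum-cong-≋ {n} (λ _ → sym (*-identityˡ x)) ⟩
    sum {n} (λ _ → 1# * x)  ≈⟨ *-distribʳ-sum {n} x (λ _ → 1#) ⟨
    sum {n} (λ _ → 1#) * x  ≈⟨ *-congʳ (sum-replicate n) ⟩
    fromℕ n * x             ∎

  𝟙 : ∀ {P : Set} → Dec P → ℝ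
  𝟙 p = if does p then 1# else 0#

  𝟙-nonneg : ∀ {P : Set} (p : Dec P) → 0# ≤ 𝟙 p
  𝟙-nonneg (yes _) = 0≤1
  𝟙-nonneg (no  _) = ≤-refl

  δ : ∀ {n} → Fin n → Fin n → ℝ
  δ x y = 𝟙 (x Fin.≟ y)

  δ-refl : ∀ {n} (x : Fin n) → δ x x ≈ 1#
  δ-refl x with x Fin.≟ x
  ... | yes _   = refl
  ... | no x≢x = contradiction ≡.refl x≢x

  δ-≢ : ∀ {n} {x y : Fin n} → x ≢ y → δ x y ≈ 0#
  δ-≢ {x = x} {y} x≢y with x Fin.≟ y
  ... | yes x≡y = contradiction x≡y x≢y
  ... | no  _   = refl

  sum-δ : ∀ {n} (x : Fin n) (f : Fin n → ℝ) → sum (λ y → δ x y * f y) ≈ f x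
  sum-δ zero f = begin-equality
    1# * f zero + sum (λ y → 0# * f (suc y))
      ≈⟨ +-cong (*-identityˡ _) (sum-zero (λ y → zeroˡ (f (suc y)))) ⟩
    f zero + 0#                               ≈⟨ +-identityʳ _ ⟩
    f zero                                    ∎
  sum-δ (suc x) f = begin-equality
    0# * f zero + sum (λ y → δ (suc x) (suc y) * f (suc y))
      ≈⟨ +-cong (zeroˡ _) (sum-cong-≋ (λ y → *-congʳ (δ-suc y))) ⟩
    0# + sum (λ y → δ x y * f (suc y)) ≈⟨ +-identityˡ _ ⟩
    sum (λ y → δ x y * f (suc y))      ≈⟨ sum-δ x (f ∘ suc) ⟩
    f (suc x)                          ∎
    where
    δ-suc : ∀ y → δ (suc x) (suc y) ≈ δ x y
    δ-suc y with x Fin.≟ y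
    ... | yes _ = refl
    ... | no  _ = refl

  δ-sym : ∀ {n} (x y : Fin n) → δ x y ≈ δ y x
  δ-sym x y with x Fin.≟ y
  ... | yes ≡.refl = sym (δ-refl x)
  ... | no  x≢y    = sym (δ-≢ (x≢y ∘ ≡.sym))

  sum-++ : ∀ m {n} (f : Fin (m ℕ.+ n) → ℝ) →
           sum f ≈ sum (λ i → f (i ↑ˡ n)) + sum (λ j → f (m ↑ʳ j))
  sum-++ zero    f = sym (+-identityˡ _)
  sum-++ (suc m) f = trans (+-congˡ (sum-++ m (f ∘ suc))) (sym (+-assoc _ _ _))

  sum-combine : ∀ m {n} (f : Fin (m ℕ.* n) → ℝ) →
                sum f ≈ sum {m} (λ i → sum {n} (λ j → f (combine i j)))
  sum-combine zero        f = refl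
  sum-combine (suc m) {n} f = trans (sum-++ n f) (+-congˡ (sum-combine m (λ e → f (n ↑ʳ e))))

  -- Edges are stored as indices below a product; this turns a sum over edges into a double sum over
  -- endpoints.
  sum-quot-rem : ∀ m n (f : Fin m → Fin n → ℝ) →
                 sum {m ℕ.* n} (λ e → f (quotient n e) (remainder {m} n e)) ≈
                 sum (λ i → sum (f i))
  sum-quot-rem m n f = trans (sum-combine m (λ e → f (quotient n e) (remainder {m} n e)))
    (sum-cong-≋ (λ i → sum-cong-≋ (λ j → reflexive
      (≡.cong (λ p → f (proj₁ p) (proj₂ p)) (Fin.remQuot-combine i j)))))

  psum : (ℕ → ℝ) → ℕ → ℝ
  psum f N = sum {N} (λ i → f (toℕ i))

  -- `sum` unfolds at its first term, whereas inductions on time split off the last one.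
  psum-suc : ∀ f N → psum f (suc N) ≈ psum f N + f N
  psum-suc f zero    = trans (+-identityʳ _) (sym (+-identityˡ _))
  psum-suc f (suc N) = trans (+-congˡ (psum-suc (f ∘ suc) N)) (sym (+-assoc _ _ _))

  psum-mono : ∀ f → (∀ t → 0# ≤ f t) → ∀ {M N} → M ℕ.≤ N → psum f M ≤ psum f N
  psum-mono f 0≤f {N = N} ℕ.z≤n = sum-nonneg {N} (0≤f ∘ toℕ)
  psum-mono f 0≤f (ℕ.s≤s M≤N)   = +-monoʳ-≤ _ (psum-mono (f ∘ suc) (0≤f ∘ suc) M≤N)

  psum-eventually-zero : ∀ f m → (∀ t → 0# ≤ f t) → (∀ t → m ℕ.≤ t → f t ≈ 0#) →
                         ∀ N → psum f N ≤ psum f m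
  psum-eventually-zero f m       0≤f tail zero    = sum-nonneg {m} (0≤f ∘ toℕ)
  psum-eventually-zero f zero    0≤f tail (suc N) =
    ≤-reflexive (sum-zero {suc N} (λ i → tail (toℕ i) ℕ.z≤n))
  psum-eventually-zero f (suc m) 0≤f tail (suc N) =
    +-monoʳ-≤ _ (psum-eventually-zero (f ∘ suc) m (0≤f ∘ suc) (λ t m≤t → tail (suc t) (ℕ.s≤s m≤t)) N)

  -- Archimedean property and integer parts

  module Floor (em : ExcludedMiddle 0ℓ) where

    -- Otherwise the natural numbers have a supremum `u`. Since `N + 1` is at most `u` for every
    -- `N`, `u - 1` is an upper bound too, against leastness.
    archimedean : ∀ r → ∃ λ N → ¬ (fromℕ (suc N) ≤ r)
    archimedean r with em {∃ λ N → ¬ (fromℕ (suc N) ≤ r)}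
    ... | yes found = found
    ... | no  none  = contradiction (+-cancelʳ-≤ u (begin
        1# + u   ≈⟨ +-comm 1# u ⟩
        u + 1#   ≤⟨ x≤z-y⇒x+y≤z (least (λ { (N , ≡.refl) → shifted N })) ⟩
        u        ≈⟨ +-identityˡ u ⟨
        0# + u   ∎)) 1≰0
      where
      bounded : ∀ N → fromℕ N ≤ r
      bounded N with em {fromℕ (suc N) ≤ r}
      ... | yes le = ≤-trans (fromℕ-mono (ℕ.n≤1+n N)) le
      ... | no nle = contradiction (N , nle) none
      supremum = complete (λ x → ∃ λ N → x ≡ fromℕ N) (0# , 0 , ≡.refl)
                          (r , λ { (N , ≡.refl) → bounded N })
      u = proj₁ supremum
      least = proj₂ (proj₂ supremum)
      shifted : ∀ N → fromℕ N ≤ u + - 1#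
      shifted N = x+y≤z⇒x≤z-y (≤-trans (≤-reflexive (+-comm _ _))
                    (proj₁ (proj₂ supremum) (suc N , ≡.refl)))

    -- Negative reals have floor 0 here.
    IsFloor : ℝ → ℕ → Set
    IsFloor r m = (m ≡ 0 ⊎ fromℕ m ≤ r) × ¬ (fromℕ (suc m) ≤ r)

    -- Searches downwards from a known strict bound and stops at the first number not above `r`, or
    -- at 0.
    floor-below : ∀ r N → ¬ (fromℕ (suc N) ≤ r) → ∃ (IsFloor r)
    floor-below r zero    r<1+N = 0 , inj₁ ≡.refl , r<1+N
    floor-below r (suc N) r<2+N with em {fromℕ (suc N) ≤ r}
    ... | yes 1+N≤r = suc N , inj₂ 1+N≤r , r<2+N
    ... | no  r<1+N = floor-below r N r<1+N

    floorOf : ∀ r → ∃ (IsFloor r)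
    floorOf r = floor-below r (proj₁ (archimedean r)) (proj₂ (archimedean r))

    ⌊_⌋ : ℝ → ℕ
    ⌊ r ⌋ = proj₁ (floorOf r)

    ⌊⌋-lower : ∀ {r} → 0# ≤ r → fromℕ ⌊ r ⌋ ≤ r
    ⌊⌋-lower {r} 0≤r with floorOf r
    ... | .0 , inj₁ ≡.refl , _ = 0≤r
    ... | _  , inj₂ m≤r    , _ = m≤r

    ⌊⌋-upper : ∀ r → r ≤ fromℕ ⌊ r ⌋ + 1#
    ⌊⌋-upper r with total r (fromℕ (suc ⌊ r ⌋))
    ... | inj₁ r≤1+m = ≤-trans r≤1+m (≤-reflexive (+-comm 1# _))
    ... | inj₂ 1+m≤r = contradiction 1+m≤r (proj₂ (proj₂ (floorOf r)))

    ⌊⌋-mono : ∀ {r r′} → r ≤ r′ → ⌊ r ⌋ ℕ.≤ ⌊ r′ ⌋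
    ⌊⌋-mono {r} {r′} r≤r′ with floorOf r | floorOf r′
    ... | .0 , inj₁ ≡.refl , _ | _ = ℕ.z≤n
    ... | m , inj₂ m≤r , _ | m′ , _ , r′<1+m′ = ℕ.≮⇒≥ λ m′<m →
      r′<1+m′ (≤-trans (fromℕ-mono m′<m) (≤-trans m≤r r≤r′))

    ⌊⌋-cong : ∀ {r r′} → r ≈ r′ → ⌊ r ⌋ ≡ ⌊ r′ ⌋
    ⌊⌋-cong r≈r′ = ℕ.≤-antisym (⌊⌋-mono (≤-reflexive r≈r′)) (⌊⌋-mono (≤-reflexive (sym r≈r′)))

-- Agents following a table of offered moves

sumℕ-mono : ∀ {n} {f g : Fin n → ℕ} → (∀ i → f i ℕ.≤ g i) → sumℕ f ℕ.≤ sumℕ g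
sumℕ-mono {zero}  f≤g = ℕ.z≤n
sumℕ-mono {suc n} f≤g = ℕ.+-mono-≤ (f≤g zero) (sumℕ-mono (f≤g ∘ suc))

sumℕ-mono-< : ∀ {n} {f g : Fin n → ℕ} → (∀ i → f i ℕ.≤ g i) →
              ∀ i → f i ℕ.< g i → sumℕ f ℕ.< sumℕ g
sumℕ-mono-< f≤g zero    f<g = ℕ.+-mono-<-≤ f<g (sumℕ-mono (f≤g ∘ suc))
sumℕ-mono-< f≤g (suc i) f<g = ℕ.+-mono-≤-< (f≤g zero) (sumℕ-mono-< (f≤g ∘ suc) i f<g)

module Dispatch {n k m : ℕ} (src tgt : Fin m → Fin n) where

  -- `used` counts the moves along each edge since the start. It is never reset, so it is compared
  -- with cumulative offers.
  record State : Set where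
    constructor state
    field
      pos  : Fin k → Fin n
      used : Fin m → ℕ
  open State public

  advance : State → Fin k → Fin m → State
  advance σ i e .pos  j = if does (i Fin.≟ j) then tgt e else pos σ j
  advance σ i e .used f = if does (e Fin.≟ f) then suc (used σ f) else used σ f

  Enabled : (Fin m → ℕ) → State → Fin k → Fin m → Set
  Enabled G σ i e = pos σ i ≡ src e × used σ e ℕ.< G e

  Saturated : (Fin m → ℕ) → State → Set
  Saturated G σ = ∀ i e → ¬ Enabled G σ i e

  _≼_ : State → (Fin m → ℕ) → Set
  σ ≼ G = ∀ e → used σ e ℕ.≤ G e

  infix 3 _⊢_↠_
  data _⊢_↠_ (G : Fin m → ℕ) : State → State → Set where
    done : ∀ {σ} → G ⊢ σ ↠ σ
    move : ∀ {σ σ′} i e → Enabled G σ i e → G ⊢ advance σ i e ↠ σ′ → G ⊢ σ ↠ σ′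

  pending : (Fin m → ℕ) → State → ℕ
  pending G σ = sumℕ (λ e → G e ℕ.∸ used σ e)

  advance-used : ∀ σ i e f → used σ f ℕ.≤ used (advance σ i e) f
  advance-used σ i e f with e Fin.≟ f
  ... | yes _ = ℕ.n≤1+n _
  ... | no  _ = ℕ.≤-refl

  pending-decreases : ∀ G σ i e → used σ e ℕ.< G e → pending G (advance σ i e) ℕ.< pending G σ
  pending-decreases G σ i e used<G =
    sumℕ-mono-< (λ f → ℕ.∸-monoʳ-≤ (G f) (advance-used σ i e f)) e strict
    where
    strict : G e ℕ.∸ used (advance σ i e) e ℕ.< G e ℕ.∸ used σ e
    strict with e Fin.≟ e
    ... | yes _  = ℕ.∸-monoʳ-< (ℕ.n<1+n _) used<G
    ... | no e≢e = contradiction ≡.refl e≢e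

  -- Each move lowers `pending`, so the process stops. Which enabled move is chosen is immaterial:
  -- the estimates use only that moves respect the offers and that the final state is saturated.
  settleWithin : ∀ fuel G σ → pending G σ ℕ.≤ fuel → ∃ λ σ′ → (G ⊢ σ ↠ σ′) × Saturated G σ′
  settleWithin fuel G σ bound
    with Fin.any? (λ i → Fin.any? (λ e → (pos σ i Fin.≟ src e) ×-dec (used σ e ℕ.<? G e)))
  ... | no  stuck = σ , done , λ i e enabled → stuck (i , e , enabled)
  settleWithin zero G σ bound | yes (i , e , enabled) =
    contradiction (ℕ.<-≤-trans (pending-decreases G σ i e (proj₂ enabled)) bound) λ ()
  settleWithin (suc fuel) G σ bound | yes (i , e , enabled) =
    let σ′ , moves , saturated = settleWithin fuel G (advance σ i e)
          (ℕ.≤-pred (ℕ.<-≤-trans (pending-decreases G σ i e (proj₂ enabled)) bound))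
    in  σ′ , move i e enabled moves , saturated

  settle : ∀ G σ → ∃ λ σ′ → (G ⊢ σ ↠ σ′) × Saturated G σ′
  settle G σ = settleWithin (pending G σ) G σ ℕ.≤-refl

  ↠-≼ : ∀ {G σ σ′} → G ⊢ σ ↠ σ′ → σ ≼ G → σ′ ≼ G
  ↠-≼ done                          σ≼G = σ≼G
  ↠-≼ {σ = σ} (move i e (_ , <G) moves) σ≼G = ↠-≼ moves step
    where
    step : advance σ i e ≼ _
    step f with e Fin.≟ f
    ... | yes ≡.refl = <G
    ... | no  _      = σ≼G f

  initial : Fin n → State
  initial x₀ .pos  _ = x₀
  initial x₀ .used _ = 0

  -- Agents act on `G 0` already at time 0, which spreads them out from `x₀` before any cost vector
  -- arrives.
  trajectory : Fin n → (ℕ → Fin m → ℕ) → ℕ → State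
  trajectory x₀ G zero    = proj₁ (settle (G 0) (initial x₀))
  trajectory x₀ G (suc t) = proj₁ (settle (G (suc t)) (trajectory x₀ G t))

  -- The online property: later tables do not influence the state at time `t`.
  trajectory-cong : ∀ x₀ {G G′} t → (∀ {s} → s ℕ.≤ t → G s ≡ G′ s) →
                    trajectory x₀ G t ≡ trajectory x₀ G′ t
  trajectory-cong x₀ zero    G≡G′ = ≡.cong (λ g → proj₁ (settle g (initial x₀))) (G≡G′ ℕ.z≤n)
  trajectory-cong x₀ (suc t) G≡G′ = ≡.cong₂ (λ g σ → proj₁ (settle g σ)) (G≡G′ ℕ.≤-refl)
    (trajectory-cong x₀ t (λ s≤t → G≡G′ (ℕ.m≤n⇒m≤1+n s≤t)))

  trajectory-saturated : ∀ x₀ G t → Saturated (G t) (trajectory x₀ G t)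
  trajectory-saturated x₀ G zero    = proj₂ (proj₂ (settle (G 0) (initial x₀)))
  trajectory-saturated x₀ G (suc t) = proj₂ (proj₂ (settle (G (suc t)) (trajectory x₀ G t)))

  trajectory-≼ : ∀ x₀ {G} → (∀ t e → G t e ℕ.≤ G (suc t) e) → ∀ t → trajectory x₀ G t ≼ G t
  trajectory-≼ x₀ {G} mono zero    = ↠-≼ (proj₁ (proj₂ (settle (G 0) (initial x₀)))) (λ _ → ℕ.z≤n)
  trajectory-≼ x₀ {G} mono (suc t) = ↠-≼ (proj₁ (proj₂ (settle (G (suc t)) (trajectory x₀ G t))))
    (λ e → ℕ.≤-trans (trajectory-≼ x₀ mono t e) (mono t e))

  -- Conservation, occupancy and work of the agents

  module Accounting (ℛ : CompleteOrderedField) where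
    open CompleteOrderedField ℛ hiding (zero)
    open OrderedField ℛ

    occupancy : State → Fin n → ℝ
    occupancy σ x = sum (λ i → δ (pos σ i) x)

    outflow inflow : (Fin m → ℝ) → Fin n → ℝ
    outflow F x = sum (λ e → δ (src e) x * F e)
    inflow  F x = sum (λ e → δ (tgt e) x * F e)

    executed : State → Fin m → ℝ
    executed σ e = fromℕ (used σ e)

    -- Conservation of agents at each point, with `D` the initial numbers and departures and
    -- arrivals counted from the start.
    Balanced : (Fin n → ℝ) → State → Set
    Balanced D σ = ∀ x → occupancy σ x + outflow (executed σ) x ≈ D x + inflow (executed σ) x

    -- A move raises a single counter by 1. The weight `w` is arbitrary so that outflow, inflow and
    -- work are all covered.
    advance-executed : ∀ (w : Fin m → ℝ) σ i e →
      sum (λ f → w f * executed (advance σ i e) f) ≈ w e + sum (λ f → w f * executed σ f)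
    advance-executed w σ i e = begin-equality
      sum (λ f → w f * executed (advance σ i e) f)         ≈⟨ sum-cong-≋ pointwise ⟩
      sum (λ f → δ e f * w f + w f * executed σ f)         ≈⟨ ∑-distrib-+ (λ f → δ e f * w f) _ ⟩
      sum (λ f → δ e f * w f) + sum (λ f → w f * executed σ f) ≈⟨ +-congʳ (sum-δ e w) ⟩
      w e + sum (λ f → w f * executed σ f)                 ∎
      where
      pointwise : ∀ f → w f * executed (advance σ i e) f ≈ δ e f * w f + w f * executed σ f
      pointwise f with e Fin.≟ f
      ... | yes _ = solve 2 (λ a b → a :* (con 1 :+ b) := con 1 :* a :+ a :* b) refl (w f) (executed σ f)
      ... | no  _ = solve 2 (λ a b → a :* b := con 0 :* a :+ a :* b) refl (w f) (executed σ f)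

    -- One term `g (src e)` is replaced by `g (tgt e)`. Writing both on opposite sides avoids
    -- subtraction and stays within semiring identities.
    advance-pos : ∀ (g : Fin n → ℝ) σ i e → pos σ i ≡ src e →
      sum (λ j → g (pos (advance σ i e) j)) + g (src e) ≈ sum (λ j → g (pos σ j)) + g (tgt e)
    advance-pos g σ i e at-src = begin-equality
      sum (λ j → g (pos (advance σ i e) j)) + g (src e)     ≈⟨ +-congˡ (sum-δ i (λ _ → g (src e))) ⟨
      _ + sum (λ j → δ i j * g (src e))                     ≈⟨ ∑-distrib-+ (λ j → g (pos (advance σ i e) j)) _ ⟨
      sum (λ j → g (pos (advance σ i e) j) + δ i j * g (src e)) ≈⟨ sum-cong-≋ pointwise ⟩
      sum (λ j → g (pos σ j) + δ i j * g (tgt e))           ≈⟨ ∑-distrib-+ (λ j → g (pos σ j)) _ ⟩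
      _ + sum (λ j → δ i j * g (tgt e))                     ≈⟨ +-congˡ (sum-δ i (λ _ → g (tgt e))) ⟩
      sum (λ j → g (pos σ j)) + g (tgt e)                   ∎
      where
      pointwise : ∀ j → g (pos (advance σ i e) j) + δ i j * g (src e) ≈ g (pos σ j) + δ i j * g (tgt e)
      pointwise j with i Fin.≟ j
      ... | yes ≡.refl rewrite at-src =
        solve 2 (λ a b → a :+ con 1 :* b := b :+ con 1 :* a) refl (g (tgt e)) (g (src e))
      ... | no  _ = +-congˡ (trans (zeroˡ _) (sym (zeroˡ _)))

    advance-balanced : ∀ {D} σ i e → pos σ i ≡ src e → Balanced D σ → Balanced D (advance σ i e)
    advance-balanced {D} σ i e at-src balanced x = begin-equality
      occupancy σ′ x + outflow (executed σ′) x
        ≈⟨ +-congˡ (advance-executed (λ f → δ (src f) x) σ i e) ⟩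
      occupancy σ′ x + (δ (src e) x + outflow (executed σ) x)
        ≈⟨ +-assoc _ _ _ ⟨
      occupancy σ′ x + δ (src e) x + outflow (executed σ) x
        ≈⟨ +-congʳ (advance-pos (λ y → δ y x) σ i e at-src) ⟩
      occupancy σ x + δ (tgt e) x + outflow (executed σ) x
        ≈⟨ solve 3 (λ a b c → a :+ b :+ c := a :+ c :+ b) refl _ _ _ ⟩
      occupancy σ x + outflow (executed σ) x + δ (tgt e) x
        ≈⟨ +-congʳ (balanced x) ⟩
      D x + inflow (executed σ) x + δ (tgt e) x
        ≈⟨ solve 3 (λ a b c → a :+ b :+ c := a :+ (c :+ b)) refl _ _ _ ⟩
      D x + (δ (tgt e) x + inflow (executed σ) x)
        ≈⟨ +-congˡ (advance-executed (λ f → δ (tgt f) x) σ i e) ⟨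
      D x + inflow (executed σ′) x ∎
      where σ′ = advance σ i e

    ↠-balanced : ∀ {G D σ σ′} → G ⊢ σ ↠ σ′ → Balanced D σ → Balanced D σ′
    ↠-balanced done                               balanced = balanced
    ↠-balanced (move i e (at-src , _) moves) balanced =
      ↠-balanced moves (advance-balanced _ i e at-src balanced)

    supply : Fin n → Fin n → ℝ
    supply x₀ x = fromℕ k * δ x₀ x

    trajectory-balanced : ∀ x₀ G t → Balanced (supply x₀) (trajectory x₀ G t)
    trajectory-balanced x₀ G zero = ↠-balanced (proj₁ (proj₂ (settle (G 0) (initial x₀)))) λ x →
      +-cong (sum-const k _) (trans (sum-zero {m} (λ e → zeroʳ _)) (sym (sum-zero {m} (λ e → zeroʳ _))))
    trajectory-balanced x₀ G (suc t) =
      ↠-balanced (proj₁ (proj₂ (settle (G (suc t)) (trajectory x₀ G t)))) (trajectory-balanced x₀ G t)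

    -- No offer is pending at an occupied point, so its departures fall short of the flow by at
    -- most 1 per outgoing edge, while its arrivals never exceed the flow.
    occupancy-bound : ∀ {D σ G} → Balanced D σ → σ ≼ G → Saturated G σ →
      ∀ {F} → (∀ e → fromℕ (G e) ≤ F e) → (∀ e → F e ≤ fromℕ (G e) + 1#) →
      ∀ x {q} → 0# ≤ q → D x + inflow F x + outflow (λ _ → 1#) x ≤ q + outflow F x →
      occupancy σ x ≤ q
    occupancy-bound {D} {σ} {G} balanced σ≼G saturated {F} G≤F F≤G+1 x {q} 0≤q le
      with Fin.any? (λ i → pos σ i Fin.≟ x)
    -- At an empty point saturation gives no information, and the nonnegativity of `q` settles the
    -- claim.
    ... | no  empty = ≤-trans (≤-reflexive (sum-zero (λ i → δ-≢ (λ at-x → empty (i , at-x))))) 0≤q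
    ... | yes (i , at-x) = +-cancelʳ-≤ (outflow F x) (begin
      occupancy σ x + outflow F x
        ≤⟨ +-monoʳ-≤ _ (sum-mono (λ e → *-monoˡ-≤ (𝟙-nonneg (src e Fin.≟ x)) (F≤G+1 e))) ⟩
      occupancy σ x + outflow (λ e → fromℕ (G e) + 1#) x
        ≈⟨ +-congˡ (trans (sum-cong-≋ (λ e → distribˡ (δ (src e) x) _ _)) (∑-distrib-+ (λ e → δ (src e) x * fromℕ (G e)) _)) ⟩
      occupancy σ x + (outflow (λ e → fromℕ (G e)) x + outflow (λ _ → 1#) x)
        ≈⟨ +-congˡ (+-congʳ (sum-cong-≋ departures)) ⟨
      occupancy σ x + (outflow (executed σ) x + outflow (λ _ → 1#) x)
        ≈⟨ +-assoc _ _ _ ⟨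
      occupancy σ x + outflow (executed σ) x + outflow (λ _ → 1#) x
        ≈⟨ +-congʳ (balanced x) ⟩
      D x + inflow (executed σ) x + outflow (λ _ → 1#) x
        ≤⟨ +-monoˡ-≤ _ (+-monoʳ-≤ _ (sum-mono (λ e → *-monoˡ-≤ (𝟙-nonneg (tgt e Fin.≟ x))
             (≤-trans (fromℕ-mono (σ≼G e)) (G≤F e))))) ⟩
      D x + inflow F x + outflow (λ _ → 1#) x
        ≤⟨ le ⟩
      q + outflow F x ∎)
      where
      departures : ∀ e → δ (src e) x * executed σ e ≈ δ (src e) x * fromℕ (G e)
      departures e with src e Fin.≟ x
      ... | no  _   = trans (zeroˡ _) (sym (zeroˡ _))
      ... | yes src≡x = *-congˡ (reflexive (≡.cong fromℕ (ℕ.≤-antisym (σ≼G e)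
        (ℕ.≮⇒≥ (λ used<G → saturated i e (≡.trans at-x (≡.sym src≡x) , used<G))))))

    sum-over-agents : ∀ σ (c : Fin n → ℝ) → sum (λ i → c (pos σ i)) ≈ sum (λ x → occupancy σ x * c x)
    sum-over-agents σ c = begin-equality
      sum (λ i → c (pos σ i))                        ≈⟨ sum-cong-≋ (λ i → sum-δ (pos σ i) c) ⟨
      sum (λ i → sum (λ x → δ (pos σ i) x * c x))    ≈⟨ ∑-comm (λ i x → δ (pos σ i) x * c x) ⟩
      sum (λ x → sum (λ i → δ (pos σ i) x * c x))    ≈⟨ sum-cong-≋ (λ x → *-distribʳ-sum (c x) (λ i → δ (pos σ i) x)) ⟨
      sum (λ x → occupancy σ x * c x)                ∎

    displacement : (Fin n → Fin n → ℝ) → State → State → ℝ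
    displacement d σ σ′ = sum (λ i → d (pos σ i) (pos σ′ i))

    work : (Fin n → Fin n → ℝ) → (Fin m → ℝ) → ℝ
    work d F = sum (λ e → d (src e) (tgt e) * F e)

    module _ (d : Fin n → Fin n → ℝ) (d-nonneg : ∀ x y → 0# ≤ d x y)
             (d-refl : ∀ x → d x x ≈ 0#) (d-triangle : ∀ x y z → d x z ≤ d x y + d y z) where

      displacement-advance : ∀ σ i e → pos σ i ≡ src e →
        displacement d σ (advance σ i e) ≈ d (src e) (tgt e)
      displacement-advance σ i e at-src =
        trans (sum-cong-≋ pointwise) (sum-δ i (λ _ → d (src e) (tgt e)))
        where
        pointwise : ∀ j → d (pos σ j) (pos (advance σ i e) j) ≈ δ i j * d (src e) (tgt e)
        pointwise j with i Fin.≟ j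
        ... | yes ≡.refl rewrite at-src = sym (*-identityˡ _)
        ... | no  _ = trans (d-refl _) (sym (zeroˡ _))

      -- An agent may make several moves before settling. By the triangle inequality its net
      -- displacement is at most the length of its route, and the lengths of all moves add up to the
      -- growth of `work`.
      ↠-work : ∀ {G σ σ′} → G ⊢ σ ↠ σ′ →
               work d (executed σ) + displacement d σ σ′ ≤ work d (executed σ′)
      ↠-work {σ = σ} done =
        ≤-reflexive (trans (+-congˡ (sum-zero (λ i → d-refl (pos σ i)))) (+-identityʳ _))
      ↠-work {σ = σ} {σ′} (move i e (at-src , _) moves) = begin
        work d (executed σ) + displacement d σ σ′
          ≤⟨ +-monoʳ-≤ _ (sum-mono (λ j → d-triangle _ (pos σ₁ j) _)) ⟩
        work d (executed σ) + sum (λ j → d (pos σ j) (pos σ₁ j) + d (pos σ₁ j) (pos σ′ j))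
          ≈⟨ +-congˡ (∑-distrib-+ (λ j → d (pos σ j) (pos σ₁ j)) _) ⟩
        work d (executed σ) + (displacement d σ σ₁ + displacement d σ₁ σ′)
          ≈⟨ +-congˡ (+-congʳ (displacement-advance σ i e at-src)) ⟩
        work d (executed σ) + (d (src e) (tgt e) + displacement d σ₁ σ′)
          ≈⟨ solve 3 (λ a b c → a :+ (b :+ c) := b :+ a :+ c) refl _ _ _ ⟩
        d (src e) (tgt e) + work d (executed σ) + displacement d σ₁ σ′
          ≈⟨ +-congʳ (advance-executed (λ f → d (src f) (tgt f)) σ i e) ⟨
        work d (executed σ₁) + displacement d σ₁ σ′
          ≤⟨ ↠-work moves ⟩
        work d (executed σ′) ∎
        where σ₁ = advance σ i e

      -- Telescoping of `↠-work`. The right side also contains the moves made before time 0, which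
      -- the left side does not charge.
      trajectory-work : ∀ x₀ G t →
        psum (λ s → displacement d (trajectory x₀ G s) (trajectory x₀ G (suc s))) t ≤
        work d (executed (trajectory x₀ G t))
      trajectory-work x₀ G zero = sum-nonneg {m} (λ e → *-nonNeg (d-nonneg _ _) (fromℕ-nonneg (used (trajectory x₀ G 0) e)))
      trajectory-work x₀ G (suc t) = begin
        psum step (suc t)                                       ≈⟨ psum-suc step t ⟩
        psum step t + step t                                    ≤⟨ +-monoˡ-≤ _ (trajectory-work x₀ G t) ⟩
        work d (executed (trajectory x₀ G t)) + step t            ≤⟨ ↠-work (proj₁ (proj₂ (settle (G (suc t)) (trajectory x₀ G t)))) ⟩
        work d (executed (trajectory x₀ G (suc t)))               ∎
        where
        step : ℕ → ℝ
        step s = displacement d (trajectory x₀ G s) (trajectory x₀ G (suc s))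

-- Measure and integration

Borel-resp : ∀ {S T} → S ≐ T → Borel S → Borel T
Borel-resp (S⊆T , T⊆S) (b , S⊆b , b⊆S) = b , S⊆b ∘ T⊆S , S⊆T ∘ b⊆S

-- `cylinder []` imposes no condition, so its complement codes the empty set.
Borel-empty : ∀ {S} → Empty S → Borel S
Borel-empty empty = complement (cylinder []) , (λ {s} Ss → contradiction Ss (empty s)) ,
                    λ ¬all → contradiction (λ ()) ¬all

-- De Morgan: codes have only complements and countable unions. The sequence `parts` repeats the
-- second complement forever, and excluded middle removes the double negations.
Borel-∩ : ExcludedMiddle 0ℓ → ∀ {S T} → Borel S → Borel T → Borel (S ∩ T)
Borel-∩ em {S} {T} (b , S⊆b , b⊆S) (b′ , T⊆b′ , b′⊆T) =
  complement (union parts) ,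
  (λ { (Ss , _) (zero , ¬b) → ¬b (S⊆b Ss) ; (_ , Ts) (suc _ , ¬b′) → ¬b′ (T⊆b′ Ts) }) ,
  λ none → b⊆S (stable λ ¬b → none (0 , ¬b)) , b′⊆T (stable λ ¬b′ → none (1 , ¬b′))
  where
  parts : ℕ → BorelCode
  parts zero    = complement b
  parts (suc _) = complement b′
  stable : ∀ {P : Set} → ¬ ¬ P → P
  stable {P} ¬¬P with em {P}
  ... | yes p = p
  ... | no ¬p = contradiction ¬p ¬¬P

module Integration (em : ExcludedMiddle 0ℓ) (ℛ : CompleteOrderedField) where
  open CompleteOrderedField ℛ hiding (zero)
  open OrderedField ℛ
  open MTS em ℛ
  open AddSupOrder _≤_ using ([_]; _≤⊤⁺)
  open AddSupEquality _≈_ using ([_])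

  ≤∞-trans : ∀ {x y z} → x ≤∞ y → y ≤∞ z → x ≤∞ z
  ≤∞-trans = AddSupOrder.≤⁺-trans _≤_ ≤-trans

  ≤∞-drop : ∀ {x y} → [ x ] ≤∞ [ y ] → x ≤ y
  ≤∞-drop [ x≤y ] = x≤y

  ⨆-upper : ∀ {I : Set} (f : I → ℝ) i → [ f i ] ≤∞ ⨆ f
  ⨆-upper f i with em {∃ (UpperBound _≤_ (λ x → x ≡ 0# ⊎ ∃ λ i → x ≡ f i))}
  ... | yes bounded =
    [ proj₁ (proj₂ (complete _ (0# , inj₁ ≡.refl) bounded)) (inj₂ (i , ≡.refl)) ]
  ... | no  _       = _ ≤⊤⁺

  -- The premise `0# ≤ b` accounts for the zero adjoined to every family.
  ⨆-least : ∀ {I : Set} (f : I → ℝ) {b} → 0# ≤ b → (∀ i → f i ≤ b) → ⨆ f ≤∞ [ b ]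
  ⨆-least f {b} 0≤b f≤b with em {∃ (UpperBound _≤_ (λ x → x ≡ 0# ⊎ ∃ λ i → x ≡ f i))}
  ... | yes bounded = [ proj₂ (proj₂ (complete _ (0# , inj₁ ≡.refl) bounded))
                          (λ { (inj₁ ≡.refl) → 0≤b ; (inj₂ (i , ≡.refl)) → f≤b i }) ]
  ... | no unbounded =
    contradiction (b , λ { (inj₁ ≡.refl) → 0≤b ; (inj₂ (i , ≡.refl)) → f≤b i }) unbounded

  ≤∞-respʳ-≈∞ : ∀ {x y v} → [ x ] ≤∞ y → y ≈∞ [ v ] → x ≤ v
  ≤∞-respʳ-≈∞ [ x≤y ] [ y≈v ] = ≤-trans x≤y (≤-reflexive y≈v)

  ≤∞-respˡ-≈∞ : ∀ {x y v} → y ≤∞ [ x ] → y ≈∞ [ v ] → v ≤ x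
  ≤∞-respˡ-≈∞ [ y≤x ] [ y≈v ] = ≤-trans (≤-reflexive (sym y≈v)) y≤x

  -- The route from countable to finite additivity: no partial sum exceeds the one at `m`, which is
  -- therefore the supremum.
  Σ∞-finite : ∀ f m {v} → (∀ t → 0# ≤ f t) → (∀ t → m ℕ.≤ t → f t ≈ 0#) →
              Σ∞ f ≈∞ [ v ] → v ≈ psum f m
  Σ∞-finite f m 0≤f tail Σ≈v = antisym
    (≤∞-respˡ-≈∞ (⨆-least (psum f) (sum-nonneg {m} (0≤f ∘ toℕ)) (psum-eventually-zero f m 0≤f tail)) Σ≈v)
    (≤∞-respʳ-≈∞ (⨆-upper (psum f) m) Σ≈v)

  -- The bound is given at a common truncation `N`. Partial sums are nondecreasing, so it also holds
  -- when the first series is cut at `M` and the others at `N`; the supremum over `M` can then be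
  -- taken first, and induction handles the rest. The real numbers `w i` stand in for series that
  -- might be infinite.
  sum-of-series : ∀ {k} (f : Fin k → ℕ → ℝ) → (∀ i t → 0# ≤ f i t) →
    ∀ {C} → (∀ N → sum (λ i → psum (f i) N) ≤ C) →
    ∀ w → (∀ i → [ w i ] ≤∞ Σ∞ (f i)) → sum w ≤ C
  sum-of-series {zero}  f 0≤f bound w w≤f = bound 0
  sum-of-series {suc k} f 0≤f {C} bound w w≤f = begin
    w zero + sum (w ∘ suc)   ≈⟨ +-comm _ _ ⟩
    sum (w ∘ suc) + w zero   ≤⟨ x≤z-y⇒x+y≤z (sum-of-series (f ∘ suc) (0≤f ∘ suc)
                                  (λ N → x+y≤z⇒x≤z-y (≤-trans (≤-reflexive (+-comm _ _)) (headed N)))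
                                  (w ∘ suc) (w≤f ∘ suc)) ⟩
    C                        ∎
    where
    rest : ℕ → ℝ
    rest N = sum (λ i → psum (f (suc i)) N)
    separate : ∀ M N → psum (f zero) M + rest N ≤ C
    separate M N = ≤-trans
      (+-mono-≤ (psum-mono (f zero) (0≤f zero) (ℕ.m≤m⊔n M N))
                (sum-mono (λ i → psum-mono (f (suc i)) (0≤f (suc i)) (ℕ.m≤n⊔m M N))))
      (bound (M ℕ.⊔ N))
    headed : ∀ N → w zero + rest N ≤ C
    -- The empty partial sum is zero, so `separate 0 N` says that `C` minus `rest N` is nonnegative,
    -- as `⨆-least` requires.
    headed N = x≤z-y⇒x+y≤z (≤∞-drop (≤∞-trans (w≤f zero)
      (⨆-least (psum (f zero)) (x+y≤z⇒x≤z-y (separate 0 N)) (λ M → x+y≤z⇒x≤z-y (separate M N)))))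

  -- Exchanging the sums over cells and seeds turns the integral of a simple function into the
  -- average of its values over the seeds. Each value lies below a series, so `sum-of-series`
  -- applies.
  𝔼-uniform-series : ∀ k → ¬ (fromℕ k ≈ 0#) → (f : Fin k → ℕ → ℝ) → (∀ i t → 0# ≤ f i t) →
    ∀ {b} → (∀ N → sum (λ i → psum (f i) N) ≤ fromℕ k * b) →
    𝔼 (uniform k) (λ i → Σ∞ (f i)) ≤∞ [ b ]
  𝔼-uniform-series k k≉0 f 0≤f {b} bound = ⨆-least ∫ 0≤b ∫≤b
    where
    ∫ = ∫simple (uniform k) {λ i → Σ∞ (f i)}
    scale : ∀ {x} → x ≤ fromℕ k * b → fromℕ k ⁻¹ * x ≤ b
    scale {x} x≤kb = begin
      fromℕ k ⁻¹ * x              ≤⟨ *-monoˡ-≤ (⁻¹-nonneg (fromℕ-nonneg k) k≉0) x≤kb ⟩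
      fromℕ k ⁻¹ * (fromℕ k * b)  ≈⟨ solve 3 (λ i m y → i :* (m :* y) := m :* i :* y) refl (fromℕ k ⁻¹) (fromℕ k) b ⟩
      fromℕ k * fromℕ k ⁻¹ * b    ≈⟨ *-congʳ (*-inverseʳ k≉0) ⟩
      1# * b                      ≈⟨ *-identityˡ b ⟩
      b                           ∎
    0≤b : 0# ≤ b
    -- The bound at `N = 0` concerns empty partial sums, so it states that `fromℕ k * b` is
    -- nonnegative.
    0≤b = ≤-trans (≤-reflexive (sym (zeroʳ _)))
            (scale (≤-trans (≤-reflexive (sym (sum-replicate-zero k))) (bound 0)))
    ∫≤b : ∀ g → ∫ g ≤ b
    ∫≤b g = begin
      sum (λ j → value j * (sum (λ i → 𝟙 (em {cell i ≡ j})) * fromℕ k ⁻¹))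
        ≈⟨ sum-cong-≋ (λ j → solve 3 (λ a b c → a :* (b :* c) := c :* (b :* a)) refl
             (value j) (sum (λ i → 𝟙 (em {cell i ≡ j}))) (fromℕ k ⁻¹)) ⟩
      sum (λ j → fromℕ k ⁻¹ * (sum (λ i → 𝟙 (em {cell i ≡ j})) * value j))
        ≈⟨ *-distribˡ-sum (fromℕ k ⁻¹) (λ j → sum (λ i → 𝟙 (em {cell i ≡ j})) * value j) ⟨
      fromℕ k ⁻¹ * sum (λ j → sum (λ i → 𝟙 (em {cell i ≡ j})) * value j)
        ≈⟨ *-congˡ (sum-cong-≋ (λ j → *-distribʳ-sum (value j) (λ i → 𝟙 (em {cell i ≡ j})))) ⟩
      fromℕ k ⁻¹ * sum (λ j → sum (λ i → 𝟙 (em {cell i ≡ j}) * value j))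
        ≈⟨ *-congˡ (∑-comm (λ j i → 𝟙 (em {cell i ≡ j}) * value j)) ⟩
      fromℕ k ⁻¹ * sum (λ i → sum (λ j → 𝟙 (em {cell i ≡ j}) * value j))
        -- `uniform` decides `cell i ≡ j` by excluded middle and `δ` by comparing indices; two
        -- decisions of one proposition agree.
        ≈⟨ *-congˡ (sum-cong-≋ (λ i → sum-cong-≋ (λ j → *-congʳ (reflexive
             (≡.cong (λ q → if q then 1# else 0#) (does-≡ (em {cell i ≡ j}) (cell i Fin.≟ j))))))) ⟩
      fromℕ k ⁻¹ * sum (λ i → sum (λ j → δ (cell i) j * value j))
        ≈⟨ *-congˡ (sum-cong-≋ (λ i → sum-δ (cell i) value)) ⟩
      fromℕ k ⁻¹ * sum (λ i → value (cell i))
        ≤⟨ scale (sum-of-series f 0≤f bound (value ∘ cell) below) ⟩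
      b ∎
      where open SimpleBelow g

  -- Laws and means of finite-valued random variables

  module Probability (μ : FairCoinMeasure) where
    open FairCoinMeasure μ

    -- A constant sequence of empty sets is disjoint with empty union. Its second partial sum
    -- already gives `Pr S + Pr S ≤ Pr S`.
    Pr-empty : ∀ {S} → Empty S → Pr S ≈ 0#
    Pr-empty {S} empty = antisym
      (+-cancelʳ-≤ (Pr S) (begin
        Pr S + Pr S          ≈⟨ +-congˡ (+-identityʳ _) ⟨
        Pr S + (Pr S + 0#)   ≤⟨ ≤∞-respʳ-≈∞ (⨆-upper (psum (λ _ → Pr S)) 2)
                                  (Pr-⋃ (λ _ → S) (λ _ → borel) (λ _ _ _ s (Ss , _) → empty s Ss)) ⟩
        Pr (⋃ ℕ (λ _ → S))   ≈⟨ Pr-cong borel ((λ Ss → 0 , Ss) , proj₂) ⟨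
        Pr S                 ≈⟨ +-identityˡ _ ⟨
        0# + Pr S            ∎))
      (Pr-nonneg borel)
      where borel = Borel-empty empty

    -- The finite family is continued by empty sets to apply countable additivity. `S′ t` asks for
    -- an index equal to `t`, so it is empty from `m` on without a case distinction.
    Pr-partition : ∀ {m} (S : Fin m → Pred Seed 0ℓ) → (∀ j → Borel (S j)) →
      (∀ i j → i ≢ j → Empty (S i ∩ S j)) →
      ∀ {T} → Borel T → T ≐ (λ s → ∃ λ j → S j s) → Pr T ≈ sum (λ j → Pr (S j))
    Pr-partition {m} S borel disjoint {T} borelT (T⊆S , S⊆T) = begin-equality
      Pr T                           ≈⟨ Pr-cong borelT (to⋃ , from⋃) ⟩
      Pr (⋃ ℕ S′)                    ≈⟨ Σ∞-finite (Pr ∘ S′) m (Pr-nonneg ∘ borel′) (λ t m≤t → Pr-empty (beyond m≤t))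
                                          (Pr-⋃ S′ borel′ disjoint′) ⟩
      sum {m} (λ j → Pr (S′ (toℕ j))) ≈⟨ sum-cong-≋ (λ j → Pr-cong (borel j) (at-toℕ j)) ⟨
      sum (λ j → Pr (S j))           ∎
      where
      S′ : ℕ → Pred Seed 0ℓ
      S′ t s = ∃ λ j → toℕ j ≡ t × S j s
      to⋃ : ∀ {s} → T s → ⋃ ℕ S′ s
      to⋃ Ts = let j , Ss = T⊆S Ts in toℕ j , j , ≡.refl , Ss
      from⋃ : ∀ {s} → ⋃ ℕ S′ s → T s
      from⋃ (_ , j , _ , Ss) = S⊆T (j , Ss)
      at-toℕ : ∀ j → S j ≐ S′ (toℕ j)
      at-toℕ j = (λ Ss → j , ≡.refl , Ss) ,
                 λ { {s} (j′ , eq , Ss) → ≡.subst (λ i → S i s) (Fin.toℕ-injective eq) Ss }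
      beyond : ∀ {t} → m ℕ.≤ t → Empty (S′ t)
      beyond m≤t s (j , ≡.refl , _) = ℕ.<⇒≱ (Fin.toℕ<n j) m≤t
      borel′ : ∀ t → Borel (S′ t)
      borel′ t with t ℕ.<? m
      ... | no  t≮m = Borel-empty (beyond (ℕ.≮⇒≥ t≮m))
      ... | yes t<m = ≡.subst (Borel ∘ S′) (Fin.toℕ-fromℕ< t<m)
                        (Borel-resp (at-toℕ (fromℕ< t<m)) (borel (fromℕ< t<m)))
      disjoint′ : ∀ t u → t ≢ u → Empty (S′ t ∩ S′ u)
      disjoint′ t u t≢u s ((i , i≡t , Si) , (j , j≡u , Sj)) =
        disjoint i j (λ i≡j → t≢u (≡.trans (≡.sym i≡t) (≡.trans (≡.cong toℕ i≡j) j≡u))) s (Si , Sj)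

    Measurable : ∀ {m} → (Seed → Fin m) → Set
    Measurable φ = ∀ j → Borel (λ s → φ s ≡ j)

    law : ∀ {m} → (Seed → Fin m) → Fin m → ℝ
    law φ j = Pr (λ s → φ s ≡ j)

    mean : ∀ {m} → (Seed → Fin m) → (Fin m → ℝ) → ℝ
    mean φ v = sum (λ j → v j * law φ j)

    law-cong : ∀ {m} {φ ψ : Seed → Fin m} → Measurable φ → (∀ s → φ s ≡ ψ s) →
               ∀ j → law φ j ≈ law ψ j
    law-cong φ-meas φ≗ψ j =
      Pr-cong (φ-meas j) ((λ {s} → ≡.trans (≡.sym (φ≗ψ s))) , λ {s} → ≡.trans (φ≗ψ s))

    law-total : ∀ {m} {φ : Seed → Fin m} → Measurable φ → sum (law φ) ≈ 1#
    law-total {φ = φ} φ-meas = begin-equality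
      sum (law φ)            ≈⟨ Pr-partition (λ j s → φ s ≡ j) φ-meas
                                  (λ i j i≢j s (φ≡i , φ≡j) → i≢j (≡.trans (≡.sym φ≡i) φ≡j))
                                  (cylinder [] , id , id)
                                  ((λ {s} _ → φ s , ≡.refl) , λ _ ()) ⟨
      Pr (Cylinder [])       ≈⟨ Pr-cylinder [] ⟩
      fromℕ 1 ⁻¹             ≈⟨ ⁻¹-cong (+-identityʳ 1#) ⟩
      1# ⁻¹                  ≈⟨ *-identityˡ _ ⟨
      1# * 1# ⁻¹             ≈⟨ *-inverseʳ (0≉1 ∘ sym) ⟩
      1#                     ∎

    -- The event `ψ s ≡ i` is split by the value `j` of `φ`; the piece for `j` is the whole event
    -- `φ s ≡ j` if `g j` is `i`, and empty otherwise.
    law-image : ∀ {m n} {φ : Seed → Fin m} {ψ : Seed → Fin n} → Measurable φ → Measurable ψ →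
      (g : Fin m → Fin n) → (∀ s → g (φ s) ≡ ψ s) →
      ∀ i → law ψ i ≈ sum (λ j → δ (g j) i * law φ j)
    law-image {φ = φ} {ψ} φ-meas ψ-meas g g∘φ≗ψ i = trans
      (Pr-partition S S-borel (λ j j′ j≢j′ s ((φ≡j , _) , (φ≡j′ , _)) → j≢j′ (≡.trans (≡.sym φ≡j) φ≡j′))
        (ψ-meas i) ((λ {s} ψ≡i → φ s , ≡.refl , ψ≡i) , λ (_ , _ , ψ≡i) → ψ≡i))
      (sum-cong-≋ restricted)
      where
      S : Fin _ → Pred Seed 0ℓ
      S j s = φ s ≡ j × ψ s ≡ i
      S-borel : ∀ j → Borel (S j)
      S-borel j = Borel-∩ em (φ-meas j) (ψ-meas i)
      restricted : ∀ j → Pr (S j) ≈ δ (g j) i * law φ j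
      restricted j with g j Fin.≟ i
      ... | yes gj≡i = trans (Pr-cong (S-borel j) (proj₁ , λ {s} φ≡j →
                         φ≡j , ≡.trans (≡.sym (g∘φ≗ψ s)) (≡.trans (≡.cong g φ≡j) gj≡i)))
                         (sym (*-identityˡ _))
      ... | no  gj≢i = trans (Pr-empty (λ s (φ≡j , ψ≡i) →
                         gj≢i (≡.trans (≡.cong g (≡.sym φ≡j)) (≡.trans (g∘φ≗ψ s) ψ≡i))))
                         (sym (zeroˡ _))

    mean-image : ∀ {m n} {φ : Seed → Fin m} {ψ : Seed → Fin n} → Measurable φ → Measurable ψ →
      (g : Fin m → Fin n) → (∀ s → g (φ s) ≡ ψ s) → ∀ v → mean ψ v ≈ mean φ (v ∘ g)
    mean-image {φ = φ} {ψ} φ-meas ψ-meas g g∘φ≗ψ v = begin-equality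
      sum (λ i → v i * law ψ i)
        ≈⟨ sum-cong-≋ (λ i → *-congˡ (law-image φ-meas ψ-meas g g∘φ≗ψ i)) ⟩
      sum (λ i → v i * sum (λ j → δ (g j) i * law φ j))
        ≈⟨ sum-cong-≋ (λ i → *-distribˡ-sum (v i) (λ j → δ (g j) i * law φ j)) ⟩
      sum (λ i → sum (λ j → v i * (δ (g j) i * law φ j)))
        ≈⟨ ∑-comm (λ i j → v i * (δ (g j) i * law φ j)) ⟩
      sum (λ j → sum (λ i → v i * (δ (g j) i * law φ j)))
        ≈⟨ sum-cong-≋ (λ j → sum-cong-≋ (λ i →
             solve 3 (λ a b c → a :* (b :* c) := b :* (a :* c)) refl (v i) (δ (g j) i) (law φ j))) ⟩
      sum (λ j → sum (λ i → δ (g j) i * (v i * law φ j)))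
        ≈⟨ sum-cong-≋ (λ j → sum-δ (g j) (λ i → v i * law φ j)) ⟩
      sum (λ j → v (g j) * law φ j) ∎

    mean-+ : ∀ {m} (φ : Seed → Fin m) v w → mean φ (λ j → v j + w j) ≈ mean φ v + mean φ w
    mean-+ φ v w = trans (sum-cong-≋ (λ j → distribʳ (law φ j) (v j) (w j)))
                         (∑-distrib-+ (λ j → v j * law φ j) (λ j → w j * law φ j))

    infixl 6 _⊗_
    -- A pair of random variables coded as one index, so that a joint law is again a `law`.
    _⊗_ : ∀ {m n} → (Seed → Fin m) → (Seed → Fin n) → Seed → Fin (m ℕ.* n)
    (φ ⊗ ψ) s = combine (φ s) (ψ s)

    quotient-⊗ : ∀ {m n} (φ : Seed → Fin m) (ψ : Seed → Fin n) s → quotient n ((φ ⊗ ψ) s) ≡ φ s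
    quotient-⊗ φ ψ s = ≡.cong proj₁ (Fin.remQuot-combine (φ s) (ψ s))

    remainder-⊗ : ∀ {m n} (φ : Seed → Fin m) (ψ : Seed → Fin n) s → remainder {m} n ((φ ⊗ ψ) s) ≡ ψ s
    remainder-⊗ φ ψ s = ≡.cong proj₂ (Fin.remQuot-combine (φ s) (ψ s))

    ⊗-measurable : ∀ {m n} {φ : Seed → Fin m} {ψ : Seed → Fin n} →
                   Measurable φ → Measurable ψ → Measurable (φ ⊗ ψ)
    ⊗-measurable {m} {n} {φ} {ψ} φ-meas ψ-meas e = Borel-resp
      ( (λ (φ≡ , ψ≡) → ≡.trans (≡.cong₂ combine φ≡ ψ≡) (Fin.combine-remQuot {m} n e))
      , (λ { {s} ≡.refl → ≡.sym (quotient-⊗ φ ψ s) , ≡.sym (remainder-⊗ φ ψ s) }) )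
      (Borel-∩ em (φ-meas (quotient n e)) (ψ-meas (remainder {m} n e)))

-- Derandomization

take-applyUpTo : ∀ {A : Set} (f : ℕ → A) {s t} → s ℕ.≤ t → take s (applyUpTo f t) ≡ applyUpTo f s
take-applyUpTo f ℕ.z≤n       = ≡.refl
take-applyUpTo f (ℕ.s≤s s≤t) = ≡.cong (f 0 ∷_) (take-applyUpTo (f ∘ suc) s≤t)

take-Pointwise : ∀ {A : Set} {R : A → A → Set} {us vs} s →
                 Pointwise R us vs → Pointwise R (take s us) (take s vs)
take-Pointwise zero    us∼vs           = []
take-Pointwise (suc s) []              = []
take-Pointwise (suc s) (u∼v ∷ us∼vs) = u∼v ∷ take-Pointwise s us∼vs

module Derandomization (em : ExcludedMiddle 0ℓ) (ℛ : CompleteOrderedField) where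
  open CompleteOrderedField ℛ hiding (zero)
  open OrderedField ℛ
  open Floor em
  open MTS em ℛ
  open Integration em ℛ
  open AddSupOrder _≤_ using ([_]; _≤⊤⁺)

  -- Distances and costs on numbered points

  module Locations {n : ℕ} (X : FiniteMetricSpace n) where
    open FiniteMetricSpace X public
    open Inverse enum public using (to; from; strictlyInverseˡ; strictlyInverseʳ)
    open IsGeneralMetric isMetric public using (nonNegative; ≈⇒0; triangle)

    dist : Fin n → Fin n → ℝ
    dist x y = d (to x) (to y)

    charge : CostVector X → Fin n → ℝ
    charge u x = proj₁ (u (to x))

    step : CostVector X → Fin n → Fin n → ℝ
    step u x y = dist x y + charge u y

    stepCost : (ℕ → Point) → (ℕ → CostVector X) → ℕ → ℝ
    stepCost ρ c t = d (ρ t) (ρ (suc t)) + proj₁ (c t (ρ (suc t)))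

    step-nonneg : ∀ u x y → 0# ≤ step u x y
    step-nonneg u x y = +-nonneg nonNegative (proj₂ (u (to y)))

    stepCost-nonneg : ∀ ρ c t → 0# ≤ stepCost ρ c t
    stepCost-nonneg ρ c t = +-nonneg nonNegative (proj₂ (c t (ρ (suc t))))

  -- Laws and expected costs of the randomized algorithm

  module Fractional {n : ℕ} (X : FiniteMetricSpace n) (μ : FairCoinMeasure)
                    (𝒜 : OnlineAlgorithm X (fairBits μ)) where
    open Locations X
    open OnlineAlgorithm 𝒜
    open Probability μ

    at : List (CostVector X) → Seed → Fin n
    at us s = from (act us s)

    at-measurable : ∀ us → Measurable (at us)
    at-measurable us j = Borel-resp
      ( (λ act≡ → ≡.trans (≡.cong from act≡) (strictlyInverseʳ j))
      , (λ {s} at≡ → ≡.trans (≡.sym (strictlyInverseˡ (act us s))) (≡.cong to at≡)) )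
      (act-measurable us (to j))

    pair-measurable : ∀ us vs → Measurable (at us ⊗ at vs)
    pair-measurable us vs = ⊗-measurable (at-measurable us) (at-measurable vs)

    flow : List (CostVector X) → List (CostVector X) → Fin (n ℕ.* n) → ℝ
    flow us vs = law (at us ⊗ at vs)

    flow-nonneg : ∀ us vs e → 0# ≤ flow us vs e
    flow-nonneg us vs e = Pr-nonneg (pair-measurable us vs e)
      where open FairCoinMeasure μ

    flow-cong : ∀ {us us′ vs vs′} → Pointwise (_≋_ X) us us′ → Pointwise (_≋_ X) vs vs′ →
                ∀ e → flow us vs e ≈ flow us′ vs′ e
    flow-cong {us} {vs = vs} us≋ vs≋ = law-cong (pair-measurable us vs) λ s →
      ≡.cong₂ combine (≡.cong from (act-cong us≋ s)) (≡.cong from (act-cong vs≋ s))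

    stage : (ℕ → CostVector X) → ℕ → Seed → Fin n
    stage c t = at (applyUpTo c t)

    stepMean : (ℕ → CostVector X) → ℕ → ℝ
    stepMean c t = mean (stage c t ⊗ stage c (suc t)) (λ e → step (c t) (quotient n e) (remainder {n} n e))

    -- Truncated costs as simple functions of the path

    module Paths (c : ℕ → CostVector X) where

      -- The number of state sequences for times 0 to `N`; `path` numbers the one followed under a
      -- given seed.
      paths : ℕ → ℕ
      paths zero    = n
      paths (suc N) = paths N ℕ.* n

      path : ∀ N → Seed → Fin (paths N)
      path zero    = stage c 0
      path (suc N) = path N ⊗ stage c (suc N)

      end : ∀ N → Fin (paths N) → Fin n
      end zero    = id
      end (suc N) = remainder {paths N} n

      cost : ∀ N → Fin (paths N) → ℝ
      cost zero    _ = 0#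
      cost (suc N) e = cost N (quotient n e) + step (c N) (end N (quotient n e)) (remainder {paths N} n e)

      path-measurable : ∀ N → Measurable (path N)
      path-measurable zero    = at-measurable _
      path-measurable (suc N) = ⊗-measurable (path-measurable N) (at-measurable _)

      end-path : ∀ N s → end N (path N s) ≡ stage c N s
      end-path zero    s = ≡.refl
      end-path (suc N) s = remainder-⊗ (path N) (stage c (suc N)) s

      cost-nonneg : ∀ N e → 0# ≤ cost N e
      cost-nonneg zero    e = ≤-refl
      cost-nonneg (suc N) e = +-nonneg (cost-nonneg N _) (step-nonneg (c N) _ _)

      cost-path : ∀ N s → cost N (path N s) ≈ psum (stepCost (run c s) c) N
      cost-path zero    s = refl
      cost-path (suc N) s = begin-equality
        cost N (quotient n e) + step (c N) (end N (quotient n e)) (remainder {paths N} n e)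
          ≡⟨ ≡.cong₂ (λ e′ y → cost N e′ + step (c N) (end N e′) y)
               (quotient-⊗ (path N) (stage c (suc N)) s) (remainder-⊗ (path N) (stage c (suc N)) s) ⟩
        cost N (path N s) + step (c N) (end N (path N s)) (stage c (suc N) s)
          ≈⟨ +-cong (cost-path N s) (reflexive (≡.cong (λ x → step (c N) x (stage c (suc N) s)) (end-path N s))) ⟩
        psum (stepCost (run c s) c) N + step (c N) (stage c N s) (stage c (suc N) s)
          ≡⟨ ≡.cong₂ (λ x y → psum (stepCost (run c s) c) N + (d x y + proj₁ (c N y)))
               (strictlyInverseˡ _) (strictlyInverseˡ _) ⟩
        psum (stepCost (run c s) c) N + stepCost (run c s) c N
          ≈⟨ psum-suc (stepCost (run c s) c) N ⟨
        psum (stepCost (run c s) c) (suc N) ∎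
        where e = path (suc N) s

      -- Linearity of expectation: the last step costs an amount that depends only on the last two
      -- states, so its mean needs only their joint law.
      mean-cost : ∀ N → mean (path N) (cost N) ≈ psum (stepMean c) N
      mean-cost zero    = sum-zero {n} (λ e → zeroˡ _)
      mean-cost (suc N) = begin-equality
        mean (path (suc N)) (cost (suc N))
          ≈⟨ mean-+ (path (suc N)) (cost N ∘ quotient n) (λ e → step′ (lastEdge e)) ⟩
        mean (path (suc N)) (cost N ∘ quotient n) + mean (path (suc N)) (λ e → step′ (lastEdge e))
          ≈⟨ +-cong
               (mean-image (path-measurable (suc N)) (path-measurable N) (quotient n)
                  (quotient-⊗ (path N) (stage c (suc N))) (cost N))
               (trans (mean-image (path-measurable (suc N)) (pair-measurable _ _) edge edge-path
                         (λ e → step (c N) (quotient n e) (remainder {n} n e)))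
                      (sum-cong-≋ (λ e → *-congʳ (reflexive
                        (≡.cong step′ (Fin.remQuot-combine (end N (quotient n e)) (remainder {paths N} n e))))))) ⟨
        mean (path N) (cost N) + stepMean c N
          ≈⟨ +-congʳ (mean-cost N) ⟩
        psum (stepMean c) N + stepMean c N
          ≈⟨ psum-suc (stepMean c) N ⟨
        psum (stepMean c) (suc N) ∎
        where
        step′ : Fin n × Fin n → ℝ
        step′ (x , y) = step (c N) x y
        lastEdge : Fin (paths (suc N)) → Fin n × Fin n
        lastEdge e = end N (quotient n e) , remainder {paths N} n e
        edge : Fin (paths (suc N)) → Fin (n ℕ.* n)
        edge e = combine (end N (quotient n e)) (remainder {paths N} n e)
        edge-path : ∀ s → edge (path (suc N) s) ≡ (stage c N ⊗ stage c (suc N)) s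
        edge-path s = ≡.cong₂ combine
          (≡.trans (≡.cong (end N) (quotient-⊗ (path N) (stage c (suc N)) s)) (end-path N s))
          (remainder-⊗ (path N) (stage c (suc N)) s)

      -- The cost of the first `N` steps takes finitely many values and lies below the total cost,
      -- so it is an admissible simple function whose integral is computed by `mean-cost`.
      psum-stepMean≤𝔼 : ∀ N → [ psum (stepMean c) N ] ≤∞ 𝔼 (fairBits μ) (λ s → Cost X (run c s) c)
      psum-stepMean≤𝔼 N = ≤∞-trans [ ≤-reflexive (sym (mean-cost N)) ]
        (⨆-upper (∫simple (fairBits μ)) (record
          { size       = paths N
          ; cell       = path N
          ; measurable = path-measurable N
          ; value      = cost N
          ; nonneg     = cost-nonneg N
          ; below      = λ s → ≤∞-trans [ ≤-reflexive (cost-path N s) ]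
                                        (⨆-upper (psum (stepCost (run c s) c)) N)
          }))

  -- The algorithm with `k` agents

  module Rounding {n : ℕ} (X : FiniteMetricSpace n) (μ : FairCoinMeasure)
                  (𝒜 : OnlineAlgorithm X (fairBits μ))
                  {ε : ℝ} (0≤ε : 0# ≤ ε) {k : ℕ} (k≉0 : ¬ (fromℕ k ≈ 0#))
                  (n²≤kε : fromℕ n * fromℕ n ≤ fromℕ k * ε) where
    open Locations X
    open Fractional X μ 𝒜
    open OnlineAlgorithm 𝒜 using (run)
    open Probability μ using (law; mean; law-total; law-image; mean-image; _⊗_; quotient-⊗; remainder-⊗)

    src tgt : Fin (n ℕ.* n) → Fin n
    src = quotient n
    tgt = remainder {n} n

    open Dispatch {k = k} src tgt
    open Accounting ℛ

    inflow-edges : ∀ (f : Fin n → Fin n → ℝ) x → inflow (λ e → f (src e) (tgt e)) x ≈ sum (λ u → f u x)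
    inflow-edges f x = trans (sum-quot-rem n n (λ u v → δ v x * f u v)) (sum-cong-≋ (λ u →
      trans (sum-cong-≋ (λ v → *-congʳ (δ-sym v x))) (sum-δ x (f u))))

    outflow-edges : ∀ (f : Fin n → Fin n → ℝ) x → outflow (λ e → f (src e) (tgt e)) x ≈ sum (f x)
    outflow-edges f x = trans (sum-quot-rem n n (λ u v → δ u x * f u v))
      (trans (∑-comm (λ u v → δ u x * f u v)) (sum-cong-≋ (λ v →
        trans (sum-cong-≋ (λ u → *-congʳ (δ-sym u x))) (sum-δ x (λ u → f u v)))))

    κ : ℝ
    κ = fromℕ k * (1# + ε)

    0≤κ : 0# ≤ κ
    0≤κ = *-nonNeg (fromℕ-nonneg k) (+-nonneg 0≤1 0≤ε)

    -- Any point can serve as the common start. Evaluating `𝒜` on the empty history exhibits one,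
    -- since `n` is not assumed positive.
    x₀ : Fin n
    x₀ = at [] (λ _ → false)

    -- Turns the k agents at x₀ into the signed amount κ p(0) − n at every other point, where p(0)
    -- is the initial law of 𝒜; the amount left at x₀ is not larger than that because κ ≥ k + n².
    setup : Fin n → Fin n → ℝ
    setup u v = δ u x₀ * (κ * law (at []) v) + δ v x₀ * fromℕ n

    -- Takes the history `h t` known at each time instead of an infinite cost sequence, because an
    -- online algorithm sees only a list and its prefixes.
    totalFlow : (ℕ → List (CostVector X)) → ℕ → Fin (n ℕ.* n) → ℝ
    totalFlow h t e = setup (src e) (tgt e) + κ * psum (λ s → flow (h s) (h (suc s)) e) t

    -- A vector, so that equal entries make equal tables without function extensionality.
    roundedFlow : (ℕ → List (CostVector X)) → ℕ → Vec ℕ (n ℕ.* n)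
    roundedFlow h t = tabulate (λ e → ⌊ totalFlow h t e ⌋)

    agents : (ℕ → List (CostVector X)) → ℕ → State
    agents h = trajectory x₀ (λ t → lookup (roundedFlow h t))

    agents-cong : ∀ {h h′} t → (∀ {s} → s ℕ.≤ t → Pointwise (_≋_ X) (h s) (h′ s)) →
                  agents h t ≡ agents h′ t
    agents-cong {h} {h′} t h≋h′ = trajectory-cong x₀ t λ {s} s≤t →
      -- The flow of step `i` involves the histories at `i` and `i + 1`; as `i` is below `s`, both
      -- times are at most `t`.
      ≡.cong lookup (tabulate-cong (λ e → ⌊⌋-cong (+-congˡ (*-congˡ (sum-cong-≋ {s} (λ i →
        flow-cong (h≋h′ (ℕ.≤-trans (ℕ.<⇒≤ (Fin.toℕ<n i)) s≤t))
                  (h≋h′ (ℕ.≤-trans (Fin.toℕ<n i) s≤t)) e))))))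

    barely : OnlineAlgorithm X (uniform k)
    barely = record
      -- All `k` agents are simulated from the start on the prefixes of the history, and the seed
      -- `i` selects the one to follow.
      { act            = λ us i → to (pos (agents (λ t → take t us) (length us)) i)
      ; act-cong       = λ {us} {vs} us≋vs i → ≡.cong (λ σ → to (pos σ i)) (≡.trans
          (agents-cong (length us) (λ {s} _ → take-Pointwise s us≋vs))
          (≡.cong (agents (λ t → take t vs)) (Pointwise.Pointwise-length us≋vs)))
      ; act-measurable = λ _ _ → tt
      }

    open OnlineAlgorithm barely using () renaming (run to run′)

    -- Prefixes of the list at time `t` agree with those of the whole input only up to `t`, which is
    -- all that `agents-cong` asks for.
    run-barely : ∀ c t i → run′ c i t ≡ to (pos (agents (applyUpTo c) t) i)
    run-barely c t i = ≡.cong (λ σ → to (pos σ i)) (≡.trans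
      (≡.cong (agents (λ s → take s (applyUpTo c t))) (length-applyUpTo c t))
      (agents-cong t (λ {s} s≤t → Pointwise.map (λ { ≡.refl _ → refl }) (Pointwise.≡⇒Pointwise-≡ (take-applyUpTo c s≤t)))))

    setup-nonneg : ∀ u v → 0# ≤ setup u v
    setup-nonneg u v = +-nonneg
      (*-nonNeg (𝟙-nonneg (u Fin.≟ x₀)) (*-nonNeg 0≤κ (Pr-nonneg (at-measurable [] v))))
      (*-nonNeg (𝟙-nonneg (v Fin.≟ x₀)) (fromℕ-nonneg n))
      where open FairCoinMeasure μ

    -- Depends on the initial law alone, so it can enter the additive constant of the competitive
    -- bound.
    setupWork : ℝ
    setupWork = work dist (λ e → setup (src e) (tgt e))

    -- Occupancy and cost of the agents on a fixed input

    module Analysis (c : ℕ → CostVector X) where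

      h : ℕ → List (CostVector X)
      h = applyUpTo c

      stepFlow : ℕ → Fin (n ℕ.* n) → ℝ
      stepFlow t = flow (h t) (h (suc t))

      F : ℕ → Fin (n ℕ.* n) → ℝ
      F = totalFlow h

      p : ℕ → Fin n → ℝ
      p t = law (stage c t)

      σ : ℕ → State
      σ = agents h

      F-zero : ∀ e → F 0 e ≈ setup (src e) (tgt e)
      F-zero e = trans (+-congˡ (zeroʳ κ)) (+-identityʳ _)

      F-suc : ∀ t e → F (suc t) e ≈ F t e + κ * stepFlow t e
      F-suc t e = trans (+-congˡ (trans (*-congˡ (psum-suc (λ s → stepFlow s e) t)) (distribˡ κ _ _)))
                        (sym (+-assoc _ _ _))

      F-mono : ∀ t e → F t e ≤ F (suc t) e
      F-mono t e = ≤-trans (x≤x+y (F t e) (*-nonNeg 0≤κ (flow-nonneg _ _ e)))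
                           (≤-reflexive (sym (F-suc t e)))

      F-nonneg : ∀ t e → 0# ≤ F t e
      F-nonneg zero    e = ≤-trans (setup-nonneg (src e) (tgt e)) (≤-reflexive (sym (F-zero e)))
      F-nonneg (suc t) e = ≤-trans (F-nonneg t e) (F-mono t e)

      sum-F-suc : ∀ t (w : Fin (n ℕ.* n) → ℝ) →
        sum (λ e → w e * F (suc t) e) ≈ sum (λ e → w e * F t e) + κ * sum (λ e → w e * stepFlow t e)
      sum-F-suc t w = begin-equality
        sum (λ e → w e * F (suc t) e)
          ≈⟨ sum-cong-≋ (λ e → trans (*-congˡ (F-suc t e))
               (solve 4 (λ a b c d → a :* (b :+ c :* d) := a :* b :+ c :* (a :* d)) refl
                 (w e) (F t e) κ (stepFlow t e))) ⟩
        sum (λ e → w e * F t e + κ * (w e * stepFlow t e))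
          ≈⟨ ∑-distrib-+ (λ e → w e * F t e) (λ e → κ * (w e * stepFlow t e)) ⟩
        sum (λ e → w e * F t e) + sum (λ e → κ * (w e * stepFlow t e))
          ≈⟨ +-congˡ (*-distribˡ-sum κ (λ e → w e * stepFlow t e)) ⟨
        sum (λ e → w e * F t e) + κ * sum (λ e → w e * stepFlow t e) ∎

      outflow-stepFlow : ∀ t x → outflow (stepFlow t) x ≈ p t x
      outflow-stepFlow t x = sym (law-image (pair-measurable (h t) (h (suc t))) (at-measurable (h t)) src
        (quotient-⊗ (stage c t) (stage c (suc t))) x)

      inflow-stepFlow : ∀ t x → inflow (stepFlow t) x ≈ p (suc t) x
      inflow-stepFlow t x = sym (law-image (pair-measurable (h t) (h (suc t))) (at-measurable (h (suc t))) tgt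
        (remainder-⊗ (stage c t) (stage c (suc t))) x)

      -- The invariant behind the occupancy bound: supply plus inflow minus outflow is at most
      -- `κ * p t x` minus the `n` edges leaving `x`. `setup` establishes it; a step adds
      -- `κ * p (suc t) x` to the inflow and `κ * p t x` to the outflow, which carries it over.
      flow-bound : ∀ t x →
        supply x₀ x + inflow (F t) x + outflow (λ _ → 1#) x ≤ κ * p t x + outflow (F t) x
      flow-bound zero x = begin
        fromℕ k * δ x₀ x + inflow (F 0) x + outflow (λ _ → 1#) x
          ≈⟨ +-cong (+-cong (*-congˡ (δ-sym x₀ x)) inflow₀)
                    (trans (outflow-edges (λ _ _ → 1#) x) (trans (sum-const n 1#) (*-identityʳ _))) ⟩
        K * Δ + (κ * p 0 x + N * (Δ * N)) + N
          ≈⟨ solve 4 (λ K Δ a N → K :* Δ :+ (a :+ N :* (Δ :* N)) :+ N := a :+ (Δ :* (K :+ N :* N) :+ N))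
               refl K Δ (κ * p 0 x) N ⟩
        κ * p 0 x + (Δ * (K + N * N) + N)
          -- The size of `k` enters here. Away from `x₀` the factor `Δ` vanishes; at `x₀` the `k`
          -- agents and the `n` units from each of `n` points must fit into `κ`.
          ≤⟨ +-monoʳ-≤ _ (+-monoˡ-≤ _ (*-monoˡ-≤ (𝟙-nonneg (x Fin.≟ x₀)) (+-monoʳ-≤ _ n²≤kε))) ⟩
        κ * p 0 x + (Δ * (K + K * ε) + N)
          ≈⟨ +-congˡ (+-congʳ (solve 3 (λ Δ K ε → Δ :* (K :+ K :* ε) := Δ :* (K :* (con 1 :+ ε)) :* con 1)
               refl Δ K ε)) ⟩
        κ * p 0 x + (Δ * κ * 1# + N)
          ≈⟨ +-congˡ outflow₀ ⟨
        κ * p 0 x + outflow (F 0) x ∎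
        where
        K = fromℕ k
        N = fromℕ n
        Δ = δ x x₀
        inflow₀ : inflow (F 0) x ≈ κ * p 0 x + N * (Δ * N)
        inflow₀ = begin-equality
          inflow (F 0) x                                ≈⟨ sum-cong-≋ (λ e → *-congˡ (F-zero e)) ⟩
          inflow (λ e → setup (src e) (tgt e)) x        ≈⟨ inflow-edges setup x ⟩
          sum (λ u → setup u x)
            ≈⟨ ∑-distrib-+ (λ u → δ u x₀ * (κ * law (at []) x)) (λ _ → Δ * N) ⟩
          sum (λ u → δ u x₀ * (κ * p 0 x)) + sum {n} (λ _ → Δ * N)
            ≈⟨ +-cong (trans (sum-cong-≋ (λ u → *-congʳ (δ-sym u x₀))) (sum-δ x₀ (λ _ → κ * p 0 x)))
                      (sum-const n (Δ * N)) ⟩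
          κ * p 0 x + N * (Δ * N) ∎
        outflow₀ : outflow (F 0) x ≈ Δ * κ * 1# + N
        outflow₀ = begin-equality
          outflow (F 0) x                               ≈⟨ sum-cong-≋ (λ e → *-congˡ (F-zero e)) ⟩
          outflow (λ e → setup (src e) (tgt e)) x       ≈⟨ outflow-edges setup x ⟩
          sum (setup x)
            ≈⟨ ∑-distrib-+ (λ v → Δ * (κ * law (at []) v)) (λ v → δ v x₀ * N) ⟩
          sum (λ v → Δ * (κ * p 0 v)) + sum (λ v → δ v x₀ * N)
            ≈⟨ +-cong (trans (sum-cong-≋ (λ v → sym (*-assoc Δ κ (p 0 v))))
                             (trans (sym (*-distribˡ-sum (Δ * κ) (p 0))) (*-congˡ (law-total (at-measurable [])))))
                      (trans (sum-cong-≋ (λ v → *-congʳ (δ-sym v x₀))) (sum-δ x₀ (λ _ → N))) ⟩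
          Δ * κ * 1# + N ∎
      flow-bound (suc t) x = begin
        supply x₀ x + inflow (F (suc t)) x + outflow (λ _ → 1#) x
          ≈⟨ +-congʳ (+-congˡ (trans (sum-F-suc t (λ e → δ (tgt e) x)) (+-congˡ (*-congˡ (inflow-stepFlow t x))))) ⟩
        supply x₀ x + (inflow (F t) x + κ * p (suc t) x) + outflow (λ _ → 1#) x
          ≈⟨ solve 4 (λ a b c d → a :+ (b :+ c) :+ d := a :+ b :+ d :+ c) refl
               (supply x₀ x) (inflow (F t) x) (κ * p (suc t) x) (outflow (λ _ → 1#) x) ⟩
        supply x₀ x + inflow (F t) x + outflow (λ _ → 1#) x + κ * p (suc t) x
          ≤⟨ +-monoˡ-≤ _ (flow-bound t x) ⟩
        κ * p t x + outflow (F t) x + κ * p (suc t) x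
          ≈⟨ solve 3 (λ a b c → a :+ b :+ c := c :+ (b :+ a)) refl
               (κ * p t x) (outflow (F t) x) (κ * p (suc t) x) ⟩
        κ * p (suc t) x + (outflow (F t) x + κ * p t x)
          ≈⟨ +-congˡ (trans (sum-F-suc t (λ e → δ (src e) x)) (+-congˡ (*-congˡ (outflow-stepFlow t x)))) ⟨
        κ * p (suc t) x + outflow (F (suc t)) x ∎

      G : ℕ → Fin (n ℕ.* n) → ℕ
      G t = lookup (roundedFlow h t)

      G≡⌊F⌋ : ∀ t e → G t e ≡ ⌊ F t e ⌋
      G≡⌊F⌋ t e = lookup∘tabulate (λ e → ⌊ F t e ⌋) e

      G≤F : ∀ t e → fromℕ (G t e) ≤ F t e
      G≤F t e rewrite G≡⌊F⌋ t e = ⌊⌋-lower (F-nonneg t e)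

      F≤G+1 : ∀ t e → F t e ≤ fromℕ (G t e) + 1#
      F≤G+1 t e rewrite G≡⌊F⌋ t e = ⌊⌋-upper (F t e)

      G-mono : ∀ t e → G t e ℕ.≤ G (suc t) e
      G-mono t e rewrite G≡⌊F⌋ t e | G≡⌊F⌋ (suc t) e = ⌊⌋-mono (F-mono t e)

      σ≼G : ∀ t → σ t ≼ G t
      σ≼G = trajectory-≼ x₀ G-mono

      occupancy≤κp : ∀ t x → occupancy (σ t) x ≤ κ * p t x
      occupancy≤κp t x = occupancy-bound (trajectory-balanced x₀ G t) (σ≼G t)
        (trajectory-saturated x₀ G t) (G≤F t) (F≤G+1 t) x
        (*-nonNeg 0≤κ (Pr-nonneg (at-measurable (h t) x))) (flow-bound t x)
        where open FairCoinMeasure μ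

      moved serve moveMean serveMean : ℕ → ℝ
      moved t      = displacement dist (σ t) (σ (suc t))
      serve t     = sum (λ i → charge (c t) (pos (σ (suc t)) i))
      moveMean t  = work dist (stepFlow t)
      serveMean t = sum (λ e → charge (c t) (tgt e) * stepFlow t e)

      stepMean-split : ∀ t → stepMean c t ≈ moveMean t + serveMean t
      stepMean-split t = trans
        (sum-cong-≋ (λ e → distribʳ (stepFlow t e) (dist (src e) (tgt e)) (charge (c t) (tgt e))))
        (∑-distrib-+ (λ e → dist (src e) (tgt e) * stepFlow t e) (λ e → charge (c t) (tgt e) * stepFlow t e))

      work-F : ∀ N → work dist (F N) ≈ setupWork + κ * psum moveMean N
      work-F zero    = trans (sum-cong-≋ (λ e → *-congˡ (F-zero e)))
                             (sym (trans (+-congˡ (zeroʳ κ)) (+-identityʳ _)))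
      work-F (suc N) = begin-equality
        work dist (F (suc N))  ≈⟨ sum-F-suc N (λ e → dist (src e) (tgt e)) ⟩
        _ + κ * moveMean N                              ≈⟨ +-congʳ (work-F N) ⟩
        setupWork + κ * psum moveMean N + κ * moveMean N
          ≈⟨ trans (+-assoc _ _ _) (+-congˡ (sym (distribˡ κ _ _))) ⟩
        setupWork + κ * (psum moveMean N + moveMean N)  ≈⟨ +-congˡ (*-congˡ (psum-suc moveMean N)) ⟨
        setupWork + κ * psum moveMean (suc N)           ∎

      -- Executed moves never outnumber the offers, which never exceed the flow, so the work of `F`
      -- bounds all movement.
      psum-moved : ∀ N → psum moved N ≤ setupWork + κ * psum moveMean N
      psum-moved N = begin
        psum moved N
          ≤⟨ trajectory-work dist (λ _ _ → nonNegative) (λ _ → ≈⇒0 ≡.refl) (λ _ _ _ → triangle _ _ _) x₀ G N ⟩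
        work dist (executed (σ N))
          ≤⟨ sum-mono (λ e → *-monoˡ-≤ nonNegative (≤-trans (fromℕ-mono (σ≼G N e)) (G≤F N e))) ⟩
        work dist (F N)
          ≈⟨ work-F N ⟩
        setupWork + κ * psum moveMean N ∎

      -- A cost vector is charged after the move, hence the occupancy at `suc t`; the target
      -- marginal of `stepFlow` then expresses the expected charge.
      serve≤ : ∀ t → serve t ≤ κ * serveMean t
      serve≤ t = begin
        sum (λ i → charge (c t) (pos (σ (suc t)) i))
          ≈⟨ sum-over-agents (σ (suc t)) (charge (c t)) ⟩
        sum (λ x → occupancy (σ (suc t)) x * charge (c t) x)
          ≤⟨ sum-mono (λ x → *-monoʳ-≤ (proj₂ (c t (to x))) (occupancy≤κp (suc t) x)) ⟩
        sum (λ x → κ * p (suc t) x * charge (c t) x)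
          ≈⟨ sum-cong-≋ (λ x → trans (*-assoc κ (p (suc t) x) _) (*-congˡ (*-comm (p (suc t) x) (charge (c t) x)))) ⟩
        sum (λ x → κ * (charge (c t) x * p (suc t) x))
          ≈⟨ *-distribˡ-sum κ (λ x → charge (c t) x * p (suc t) x) ⟨
        κ * mean (stage c (suc t)) (charge (c t))
          ≈⟨ *-congˡ (mean-image (pair-measurable (h t) (h (suc t))) (at-measurable (h (suc t))) tgt
               (remainder-⊗ (stage c t) (stage c (suc t))) (charge (c t))) ⟩
        κ * serveMean t ∎

      psum-serve : ∀ N → psum serve N ≤ κ * psum serveMean N
      psum-serve N = ≤-trans (sum-mono {N} (λ i → serve≤ (toℕ i)))
        (≤-reflexive (sym (*-distribˡ-sum {N} κ (λ i → serveMean (toℕ i)))))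

      total-cost : ∀ N → sum (λ i → psum (stepCost (run′ c i) c) N) ≤ setupWork + κ * psum (stepMean c) N
      total-cost N = begin
        sum (λ i → sum {N} (λ t → stepCost (run′ c i) c (toℕ t)))
          ≈⟨ ∑-comm {n = N} (λ i t → stepCost (run′ c i) c (toℕ t)) ⟩
        sum {N} (λ t → sum (λ i → stepCost (run′ c i) c (toℕ t)))
          ≈⟨ sum-cong-≋ {N} (λ t → trans
               (sum-cong-≋ (λ i → reflexive (≡.cong₂ (λ x y → d x y + proj₁ (c (toℕ t) y))
                 (run-barely c (toℕ t) i) (run-barely c (suc (toℕ t)) i))))
               (∑-distrib-+ (λ i → dist (pos (σ (toℕ t)) i) (pos (σ (suc (toℕ t))) i))
                            (λ i → charge (c (toℕ t)) (pos (σ (suc (toℕ t))) i)))) ⟩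
        sum {N} (λ t → moved (toℕ t) + serve (toℕ t))
          ≈⟨ ∑-distrib-+ {N} (moved ∘ toℕ) (serve ∘ toℕ) ⟩
        psum moved N + psum serve N
          ≤⟨ +-mono-≤ (psum-moved N) (psum-serve N) ⟩
        setupWork + κ * psum moveMean N + κ * psum serveMean N
          ≈⟨ trans (+-assoc _ _ _) (+-congˡ (sym (distribˡ κ _ _))) ⟩
        setupWork + κ * (psum moveMean N + psum serveMean N)
          ≈⟨ +-congˡ (*-congˡ (trans (sym (∑-distrib-+ {N} (moveMean ∘ toℕ) (serveMean ∘ toℕ)))
               (sum-cong-≋ {N} (λ t → sym (stepMean-split (toℕ t)))))) ⟩
        setupWork + κ * psum (stepMean c) N ∎

      -- Truncated expected costs are at most `B`. Dividing the agents' total by `k` turns `κ` into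
      -- `1# + ε` and leaves one `k`-th of the setup work.
      𝔼-barely : ∀ {B} → 𝔼 (fairBits μ) (λ s → Cost X (run c s) c) ≤∞ [ B ] →
        𝔼 (uniform k) (λ i → Cost X (run′ c i) c) ≤∞ [ (1# + ε) * B + fromℕ k ⁻¹ * setupWork ]
      𝔼-barely {B} 𝔼≤B = 𝔼-uniform-series k k≉0 (λ i → stepCost (run′ c i) c)
        (λ i → stepCost-nonneg (run′ c i) c) λ N → begin
          sum (λ i → psum (stepCost (run′ c i) c) N)
            ≤⟨ total-cost N ⟩
          setupWork + κ * psum (stepMean c) N
            ≤⟨ +-monoʳ-≤ _ (*-monoˡ-≤ 0≤κ (≤∞-drop (≤∞-trans (Paths.psum-stepMean≤𝔼 c N) 𝔼≤B))) ⟩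
          setupWork + κ * B
            ≈⟨ +-congʳ (trans (sym (*-identityˡ _)) (*-congʳ (sym (*-inverseʳ k≉0)))) ⟩
          fromℕ k * fromℕ k ⁻¹ * setupWork + κ * B
            ≈⟨ solve 5 (λ K I W r B → K :* I :* W :+ K :* r :* B := K :* (r :* B :+ I :* W)) refl
                 (fromℕ k) (fromℕ k ⁻¹) setupWork (1# + ε) B ⟩
          fromℕ k * ((1# + ε) * B + fromℕ k ⁻¹ * setupWork) ∎

    barely-competitive : ∀ {α} → Competitive X 𝒜 α → Competitive X barely ((1# + ε) * α)
    barely-competitive {α} (β , competitive) = β′ , λ c → transfer c (OPT X c) (competitive c)
      where
      β′ : ℝ
      β′ = (1# + ε) * β + fromℕ k ⁻¹ * setupWork
      -- The optimum is abstracted to `v` so that its finite and infinite cases can be matched; in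
      -- the infinite case the bound is infinite too.
      transfer : ∀ c v → 𝔼 (fairBits μ) (λ s → Cost X (run c s) c) ≤∞ affine α β v →
                 𝔼 (uniform k) (λ i → Cost X (run′ c i) c) ≤∞ affine ((1# + ε) * α) β′ v
      transfer c ⊤⁺    _    = _ ≤⊤⁺
      transfer c [ v ] 𝔼≤ = ≤∞-trans (Analysis.𝔼-barely c 𝔼≤) [ ≤-reflexive
        (solve 5 (λ r α v β w → r :* (α :* v :+ β) :+ w := r :* α :* v :+ (r :* β :+ w)) refl
          (1# + ε) α v β (fromℕ k ⁻¹ * setupWork)) ]

theorem1p1 :
    (em : ExcludedMiddle 0ℓ) (ℛ : CompleteOrderedField) →
    let open CompleteOrderedField ℛ
        open MTS em ℛ
    in
    (n : ℕ) (X : FiniteMetricSpace n) (ε : ℝ) → 0# < ε →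
    (k : ℕ) → fromℕ (n ℕ.^ 2) * ε ⁻¹ ≤ fromℕ k →
    (α : ℝ) → RandomizedCompetitive X α → BarelyRandomCompetitive X k ((1# + ε) * α)
theorem1p1 em ℛ n X ε (0≤ε , 0≉ε) k n²/ε≤k α (μ , 𝒜 , competitive) =
  barely , barely-competitive competitive
  where
  open CompleteOrderedField ℛ hiding (zero)
  open OrderedField ℛ
  open MTS em ℛ
  open Derandomization em ℛ

  n²≤kε : fromℕ n * fromℕ n ≤ fromℕ k * ε
  n²≤kε = begin
    fromℕ n * fromℕ n             ≈⟨ ×1-homo-* n n ⟨
    fromℕ (n ℕ.* n)               ≡⟨ ≡.cong (λ m → fromℕ (n ℕ.* m)) (ℕ.*-identityʳ n) ⟨
    fromℕ (n ℕ.^ 2)               ≈⟨ *-identityʳ _ ⟨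
    fromℕ (n ℕ.^ 2) * 1#          ≈⟨ *-congˡ (trans (*-comm _ _) (*-inverseʳ (0≉ε ∘ sym))) ⟨
    fromℕ (n ℕ.^ 2) * (ε ⁻¹ * ε)  ≈⟨ *-assoc _ _ _ ⟨
    fromℕ (n ℕ.^ 2) * ε ⁻¹ * ε    ≤⟨ *-monoʳ-≤ 0≤ε n²/ε≤k ⟩
    fromℕ k * ε                   ∎

  -- An element of `Fin m` forces `m` to be positive. The initial state of `𝒜` provides such an
  -- element for `n`, so `k = 0` would contradict `n²≤kε`.
  n²≰0 : ∀ {m} → Fin m → ¬ (fromℕ m * fromℕ m ≤ 0#)
  n²≰0 {suc m} _ le = fromℕ-suc≰0 (m ℕ.+ m ℕ.* suc m) (≤-trans (≤-reflexive (×1-homo-* (suc m) (suc m))) le)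

  k≉0 : ¬ (fromℕ k ≈ 0#)
  k≉0 k≈0 = n²≰0 (Fractional.at X μ 𝒜 [] (λ _ → false))
    (≤-trans n²≤kε (≤-reflexive (trans (*-congʳ k≈0) (zeroˡ ε))))

  open Rounding X μ 𝒜 0≤ε {k} k≉0 n²≤kε
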